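{- Let $p\equiv 1\pmod 4$ be a prime and fix any primitive root $g$ of $p$. Let $X=\{(a,b)\in V\times V : a<b<\overline{a}<\overline{b}\}$ and $L_p=(p-1)(p-5)/96$. Then $$\prod_{\substack{1\le i<j\le (p-1)/2\\ i^2+j^2\not\equiv 0 \pmod p}} (j^2-i^2)\equiv (-1)^{|X|+L_p}\prod_{\substack{r,s=1\\ r\ne s}}^{(p-1)/4}(g^{4r}-g^{4s}) \pmod p.$$
   Context: For an integer $x$, $\{x\}_p$ denotes the least nonnegative residue of $x$ modulo $p$, and $\widetilde{x}=p-\{x\}_p$ if $\{x\}_p>p/2$, while $\widetilde{x}=\{x\}_p$ if $\{x\}_p<p/2$. Let $t=\prod_{x=1}^{(p-1)/2}x$. Let $V=\{x : 1\le x\le (p-1)/2,\ x<\widetilde{tx}\}$, and for $a\in V$ put $\overline{a}=\widetilde{ta}$. -}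

module Defs where

open import Data.Nat as ℕ using (ℕ; zero; suc; _∸_; _<_; _≤_; _≟_; _<?_; _≤?_; NonZero)
open import Data.Nat.DivMod using (_%_; _/_)
open import Data.Integer as ℤ using (ℤ; +_)
open import Data.Integer.Divisibility as ℤD using ()
open import Data.List using (List; []; _∷_; foldr; map; applyUpTo; concatMap; filter; length)
open import Data.Bool using (Bool; true; false; if_then_else_; _∧_)
open import Relation.Nullary using (does; ¬_)
open import Relation.Nullary.Decidable using (⌊_⌋)
open import Relation.Binary.PropositionalEquality using (_≡_)
open import Data.Product using (_×_; _,_)

-- the list [a, a+1, ..., b] (empty if b < a)
range : ℕ → ℕ → List ℕ
range a b = applyUpTo (λ k → a ℕ.+ k) (suc b ∸ a)

prodℤ : List ℤ → ℤ
prodℤ = foldr ℤ._*_ (+ 1)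

half : ℕ → ℕ
half p = (p ∸ 1) / 2

quarter : ℕ → ℕ
quarter p = (p ∸ 1) / 4

-- x tilde : the absolute least residue's absolute value, for p ≥ 1
tilde : (p : ℕ) → .{{NonZero p}} → ℕ → ℕ
tilde p x = if ⌊ p <? 2 ℕ.* (x % p) ⌋ then p ∸ (x % p) else x % p

tval : ℕ → ℕ
tval p = (half p) ℕ.!

bar : (p : ℕ) → .{{NonZero p}} → ℕ → ℕ
bar p a = tilde p (tval p ℕ.* a)

Vlist : (p : ℕ) → .{{NonZero p}} → List ℕ
Vlist p = filter (λ x → x <? bar p x) (range 1 (half p))

Xlist : (p : ℕ) → .{{NonZero p}} → List (ℕ × ℕ)
Xlist p = concatMap (λ a → map (λ b → (a , b))
            (filter (λ b → a <? b) (filter (λ b → b <? bar p a)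
              (filter (λ b → bar p a <? bar p b) (Vlist p)))))
          (Vlist p)

cardX : (p : ℕ) → .{{NonZero p}} → ℕ
cardX p = length (Xlist p)

Lp : ℕ → ℕ
Lp p = ((p ∸ 1) ℕ.* (p ∸ 5)) / 96

IsPrimitiveRoot : (p : ℕ) → .{{NonZero p}} → ℕ → Set
IsPrimitiveRoot p g =
  ((g ℕ.^ (p ∸ 1)) % p ≡ 1 % p) ×
  (∀ k → 1 ≤ k → k < p ∸ 1 → ¬ ((g ℕ.^ k) % p ≡ 1 % p))

lhs : (p : ℕ) → .{{NonZero p}} → ℤ
lhs p = prodℤ (concatMap (λ j → concatMap (λ i →
          if ⌊ (i ℕ.* i ℕ.+ j ℕ.* j) % p ≟ 0 ⌋ then []
          else ((+ (j ℕ.* j)) ℤ.- (+ (i ℕ.* i))) ∷ [])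
          (range 1 (j ∸ 1)))
        (range 1 (half p)))

rhsProd : ℕ → ℕ → ℤ
rhsProd p g = prodℤ (concatMap (λ r → concatMap (λ s →
          if ⌊ r ≟ s ⌋ then []
          else ((+ (g ℕ.^ (4 ℕ.* r))) ℤ.- (+ (g ℕ.^ (4 ℕ.* s)))) ∷ [])
          (range 1 (quarter p)))
        (range 1 (quarter p)))

_≡_[mod_] : ℤ → ℤ → ℕ → Set
a ≡ b [mod n ] = (+ n) ℤD.∣ (a ℤ.- b)

{-# OPTIONS --safe #-}
module Submission where

open import Defs
open import Data.Nat using (ℕ; NonZero; _+_)
open import Data.Nat.DivMod using (_%_)
open import Data.Nat.Primality using (Prime)
open import Data.Integer using (_*_; _^_; -1ℤ)
open import Relation.Binary.PropositionalEquality using (_≡_)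

open import Data.Bool using (Bool; true; false; if_then_else_)
open import Data.Fin as Fin using (Fin; toℕ; fromℕ<)
open import Data.Fin.Properties using (pigeonhole; toℕ<n; fromℕ<-injective)
open import Data.Integer as ℤ using (ℤ; +_; -_; _-_; 0ℤ; 1ℤ)
open import Data.Integer.Divisibility.Signed as Signed using (∣ᵤ⇒∣; ∣⇒∣ᵤ)
import Data.Integer.Properties as ℤ
open import Data.Integer.Tactic.RingSolver using (solve-∀)
open import Data.List using (List; []; _∷_; _++_; [_]; map; filter; concatMap; length; upTo)
open import Data.List.Membership.Propositional using (_∈_)
open import Data.List.Membership.Propositional.Properties using (∈-applyUpTo⁺; ∈-applyUpTo⁻; ∈-map⁺; ∈-map⁻; ∈-upTo⁺; ∈-filter⁺; ∈-filter⁻; ∈-++⁺ˡ; ∈-++⁺ʳ; ∈-++⁻)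
open import Data.List.Membership.Propositional.Properties.WithK using (unique∧set⇒bag)
open import Data.List.Properties using (applyUpTo-∷ʳ; upTo-∷ʳ; length-applyUpTo)
open import Data.List.Relation.Binary.BagAndSetEquality using (∼bag⇒↭)
open import Data.List.Relation.Binary.Permutation.Propositional as Perm using (_↭_; prep; swap)
open import Data.List.Relation.Binary.Permutation.Propositional.Properties using (∷↭∷ʳ)
open import Data.List.Relation.Unary.All as All using ([]; _∷_)
open import Data.List.Relation.Unary.AllPairs using (AllPairs; []; _∷_)
import Data.List.Relation.Unary.AllPairs.Properties as AllPairs
open import Data.List.Relation.Unary.Any using (here; there)
open import Data.List.Relation.Unary.Unique.Propositional using (Unique)
open import Data.List.Relation.Unary.Unique.Propositional.Properties using (++⁺; applyUpTo⁺₁)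
import Data.Nat as ℕ
open import Data.Nat using (_!)
open import Data.Nat.DivMod using (_/_; m≡m%n+[m/n]*n; m%n<n; m*n/n≡m)
open import Data.Nat.Divisibility using (_∣_; divides; >⇒∤; ∣m+n∣m⇒∣n; ∣m⇒∣m*n; ∣n⇒∣m*n; m∣m*n)
open import Data.Nat.Primality using (euclidsLemma; prime⇒irreducible; prime⇒nonTrivial)
import Data.Nat.Properties as ℕ
open import Data.Nat.Tactic.RingSolver using () renaming (solve-∀ to ℕ-solve-∀)
open import Data.Product using (∃; _×_; _,_; proj₁; proj₂)
open import Data.Sum as Sum using (_⊎_; inj₁; inj₂; [_,_]′)
open import Function using (_∘_; _on_)
open import Function.Bundles using (mk⇔)
open import Level using (0ℓ)
open import Relation.Binary using (Setoid; Tri; tri<; tri≈; tri>)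
open import Relation.Binary.PropositionalEquality using (_≢_; refl; sym; trans; cong; cong₂; subst; module ≡-Reasoning)
open import Relation.Nullary using (Dec; does; yes; no; ¬_; contradiction)
open import Relation.Nullary.Decidable using (⌊_⌋; dec-true; dec-false)
open import Relation.Unary using (Pred; Decidable)

-- Write p = 4n + 1.  Since t² ≡ -1, the map a ↦ ā is a fixed-point-free involution of
-- {1, …, 2n} with ā² ≡ -a², and V picks the smaller element of each orbit.  The pairs
-- with i² + j² ≡ 0 are exactly the orbits, so the left-hand side splits into blocks
-- indexed by a < b in V, each consisting of the four pairs between {a, ā} and {b, b̄}.
-- Such a block is congruent to ±(a⁴ - b⁴)², with sign - exactly when a < b < ā < b̄.
-- As a runs over V, a⁴ runs over the fourth powers g⁴ʳ, and on the right-hand side the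
-- factors for (r , s) and (s , r) combine to -(g⁴ʳ - g⁴ˢ)².  The remaining sign
-- (-1)^(n(n-1)/2) equals (-1)^Lp, because Lp = n(n-1)/6 differs from n(n-1)/2 by an
-- even number.

-- The difficulty is sign bookkeeping. The factor j² - i² is antisymmetric, while regrouping the
-- indices by orbits forgets which of the two is larger. Each factor is therefore read as the square
-- of the larger index minus that of the smaller. This is symmetric in the pair, so a product over
-- pairs may be permuted freely, and the order of the indices survives only in the value of each
-- factor. After the reduction to blocks what remains is a product of squared differences, again
-- symmetric. Matching the fourth powers of V with the g⁴ʳ then needs only an equality of sets of
-- residues; no sign of a permutation enters. The last parity claim depends on the arithmetic of p:
-- n(n - 1)/2 - Lp = 2 Lp holds once the division by 96 in Lp is known to be exact, that is, once 3
-- divides n(n - 1). This is where p = 9, 21, 33, ... have to be excluded.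

private
  variable
    A B : Set

-- Products over lists and over pairs of list entries.

∏ : List A → (A → ℤ) → ℤ
∏ xs f = prodℤ (map f xs)

-- For symmetric `f` the value depends only on the multiset of entries (`pairs-↭`). This is what
-- allows {1, ..., 2n} to be relisted as V followed by its image under the involution.
pairs : (A → A → ℤ) → List A → ℤ
pairs f []       = 1ℤ
pairs f (x ∷ xs) = ∏ xs (f x) * pairs f xs

[ab][cd]≡[ac][bd] : ∀ a b c d → (a * b) * (c * d) ≡ (a * c) * (b * d)
[ab][cd]≡[ac][bd] = solve-∀

a[bc]≡b[ac] : ∀ a b c → a * (b * c) ≡ b * (a * c)
a[bc]≡b[ac] = solve-∀

∏-cong : {f g : A → ℤ} → (∀ x → f x ≡ g x) → ∀ xs → ∏ xs f ≡ ∏ xs g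
∏-cong f≡g []       = refl
∏-cong f≡g (x ∷ xs) = cong₂ _*_ (f≡g x) (∏-cong f≡g xs)

∏-++ : (f : A → ℤ) → ∀ xs ys → ∏ (xs ++ ys) f ≡ ∏ xs f * ∏ ys f
∏-++ f []       ys = sym (ℤ.*-identityˡ _)
∏-++ f (x ∷ xs) ys = trans (cong (f x *_) (∏-++ f xs ys)) (sym (ℤ.*-assoc (f x) _ _))

∏-* : (f g : A → ℤ) → ∀ xs → ∏ xs (λ x → f x * g x) ≡ ∏ xs f * ∏ xs g
∏-* f g []       = refl
∏-* f g (x ∷ xs) = trans (cong (f x * g x *_) (∏-* f g xs)) ([ab][cd]≡[ac][bd] (f x) (g x) _ _)

∏-↭ : (f : A → ℤ) → ∀ {xs ys} → xs ↭ ys → ∏ xs f ≡ ∏ ys f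
∏-↭ f Perm.refl        = refl
∏-↭ f (prep x p)       = cong (f x *_) (∏-↭ f p)
∏-↭ f (swap x y p)     = trans (cong (λ z → f x * (f y * z)) (∏-↭ f p)) (a[bc]≡b[ac] (f x) (f y) _)
∏-↭ f (Perm.trans p q) = trans (∏-↭ f p) (∏-↭ f q)

∏-map : (f : B → ℤ) (h : A → B) → ∀ xs → ∏ (map h xs) f ≡ ∏ xs (f ∘ h)
∏-map f h []       = refl
∏-map f h (x ∷ xs) = cong (f (h x) *_) (∏-map f h xs)

∏-concatMap : (f : B → ℤ) (h : A → List B) → ∀ xs → ∏ (concatMap h xs) f ≡ ∏ xs (λ x → ∏ (h x) f)
∏-concatMap f h []       = refl
∏-concatMap f h (x ∷ xs) = trans (∏-++ f (h x) _) (cong (∏ (h x) f *_) (∏-concatMap f h xs))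

∏-filter : {P : Pred A 0ℓ} (P? : Decidable P) (f : A → ℤ) → ∀ xs →
           ∏ (filter P? xs) f ≡ ∏ xs (λ x → if does (P? x) then f x else 1ℤ)
∏-filter P? f []       = refl
∏-filter P? f (x ∷ xs) with does (P? x)
... | true  = cong (f x *_) (∏-filter P? f xs)
... | false = trans (∏-filter P? f xs) (sym (ℤ.*-identityˡ _))

∏-const : (c : ℤ) (xs : List A) → ∏ xs (λ _ → c) ≡ c ^ length xs
∏-const c []       = refl
∏-const c (x ∷ xs) = cong (c *_) (∏-const c xs)

pairs-* : (f g : A → A → ℤ) → ∀ xs → pairs (λ x y → f x y * g x y) xs ≡ pairs f xs * pairs g xs
pairs-* f g []       = refl
pairs-* f g (x ∷ xs) = trans (cong₂ _*_ (∏-* (f x) (g x) xs) (pairs-* f g xs))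
  ([ab][cd]≡[ac][bd] (∏ xs (f x)) _ _ _)

pairs-map : (f : B → B → ℤ) (h : A → B) → ∀ xs → pairs f (map h xs) ≡ pairs (f on h) xs
pairs-map f h []       = refl
pairs-map f h (x ∷ xs) = cong₂ _*_ (∏-map (f (h x)) h xs) (pairs-map f h xs)

pairs-++ : (f : A → A → ℤ) → ∀ xs ys →
           pairs f (xs ++ ys) ≡ pairs f xs * (∏ xs (λ x → ∏ ys (f x)) * pairs f ys)
pairs-++ f []       ys = sym (trans (ℤ.*-identityˡ _) (ℤ.*-identityˡ _))
pairs-++ f (x ∷ xs) ys = trans (cong₂ _*_ (∏-++ (f x) xs ys) (pairs-++ f xs ys))
  (rearrange (∏ xs (f x)) _ _ _ _)
  where
  rearrange : ∀ a b c d e → (a * b) * (c * (d * e)) ≡ (a * c) * ((b * d) * e)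
  rearrange = solve-∀

pairs-↭ : (f : A → A → ℤ) → (∀ x y → f x y ≡ f y x) → ∀ {xs ys} → xs ↭ ys → pairs f xs ≡ pairs f ys
pairs-↭ f f-sym Perm.refl        = refl
pairs-↭ f f-sym (prep x p)       = cong₂ _*_ (∏-↭ (f x) p) (pairs-↭ f f-sym p)
pairs-↭ f f-sym (swap {xs} {ys} x y p)
  rewrite f-sym x y | ∏-↭ (f x) p | ∏-↭ (f y) p | pairs-↭ f f-sym p
  = [ab][cd]≡[ac][bd] (f y x) (∏ ys (f x)) (∏ ys (f y)) _
pairs-↭ f f-sym (Perm.trans p q) = trans (pairs-↭ f f-sym p) (pairs-↭ f f-sym q)

-- Off-diagonal cells of the square array are matched across the diagonal. This serves the cross
-- terms of a doubled list, the count of X, and the product over r ≠ s.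
∏∏≡diagonal*pairs : (f : A → A → ℤ) → ∀ xs →
  ∏ xs (λ x → ∏ xs (f x)) ≡ ∏ xs (λ x → f x x) * pairs (λ x y → f x y * f y x) xs
∏∏≡diagonal*pairs f []       = refl
∏∏≡diagonal*pairs f (x ∷ xs)
  rewrite ∏-* (λ y → f y x) (λ y → ∏ xs (f y)) xs
        | ∏∏≡diagonal*pairs f xs
        | ∏-* (f x) (λ y → f y x) xs
  = rearrange (f x x) (∏ xs (f x)) (∏ xs (λ y → f y x)) _ _
  where
  rearrange : ∀ a b c d e → (a * b) * (c * (d * e)) ≡ (a * d) * ((b * c) * e)
  rearrange = solve-∀

-- Pairs lie inside the first copy, inside the second, or across. The diagonal of the cross array
-- gives the pairs of an entry with its own image; its other cells, two for each pair of entries,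
-- join the two inner factors to make blocks of four.
pairs-doubling : (f : A → A → ℤ) (h : A → A) → ∀ xs → pairs f (xs ++ map h xs) ≡
  ∏ xs (λ x → f x (h x)) * pairs (λ x y → f x y * ((f x (h y) * f y (h x)) * f (h x) (h y))) xs
pairs-doubling f h xs = begin
  pairs f (xs ++ map h xs)
    ≡⟨ pairs-++ f xs (map h xs) ⟩
  pairs f xs * (∏ xs (λ x → ∏ (map h xs) (f x)) * pairs f (map h xs))
    ≡⟨ cong₂ (λ a b → pairs f xs * (a * b)) (∏-cong (λ x → ∏-map (f x) h xs) xs) (pairs-map f h xs) ⟩
  pairs f xs * (∏ xs (λ x → ∏ xs (λ y → f x (h y))) * pairs (f on h) xs)
    ≡⟨ cong (λ a → pairs f xs * (a * pairs (f on h) xs)) (∏∏≡diagonal*pairs (λ x y → f x (h y)) xs) ⟩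
  pairs f xs * ((diagonal * pairs cross xs) * pairs (f on h) xs)
    ≡⟨ regroup (pairs f xs) diagonal (pairs cross xs) (pairs (f on h) xs) ⟩
  diagonal * (pairs f xs * (pairs cross xs * pairs (f on h) xs))
    ≡⟨ cong (λ a → diagonal * (pairs f xs * a)) (pairs-* cross (f on h) xs) ⟨
  diagonal * (pairs f xs * pairs (λ x y → cross x y * f (h x) (h y)) xs)
    ≡⟨ cong (diagonal *_) (pairs-* f (λ x y → cross x y * f (h x) (h y)) xs) ⟨
  diagonal * pairs (λ x y → f x y * (cross x y * f (h x) (h y))) xs ∎
  where
  open ≡-Reasoning
  diagonal : ℤ
  diagonal = ∏ xs (λ x → f x (h x))
  cross : _ → _ → ℤ
  cross x y = f x (h y) * f y (h x)
  regroup : ∀ a b c d → a * ((b * c) * d) ≡ b * (a * (c * d))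
  regroup = solve-∀

-- From the nested list products of the statement to products over pairs.

if-yes : {P : Set} (P? : Dec P) → P → {x y : A} → (if ⌊ P? ⌋ then x else y) ≡ x
if-yes (yes _) _ = refl
if-yes (no ¬P) P = contradiction P ¬P

if-no : {P : Set} (P? : Dec P) → ¬ P → {x y : A} → (if ⌊ P? ⌋ then x else y) ≡ y
if-no (yes P) ¬P = contradiction P ¬P
if-no (no _)  _  = refl

prodℤ-concatMap : (h : A → List ℤ) → ∀ xs → prodℤ (concatMap h xs) ≡ ∏ xs (prodℤ ∘ h)
prodℤ-concatMap h []       = refl
prodℤ-concatMap h (x ∷ xs) = trans (prodℤ-++ (h x) _) (cong (prodℤ (h x) *_) (prodℤ-concatMap h xs))
  where
  prodℤ-++ : ∀ as bs → prodℤ (as ++ bs) ≡ prodℤ as * prodℤ bs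
  prodℤ-++ []       bs = sym (ℤ.*-identityˡ _)
  prodℤ-++ (a ∷ as) bs = trans (cong (a *_) (prodℤ-++ as bs)) (sym (ℤ.*-assoc a _ _))

prodℤ-if : (b : Bool) (z : ℤ) → prodℤ (if b then [] else z ∷ []) ≡ (if b then 1ℤ else z)
prodℤ-if true  z = refl
prodℤ-if false z = ℤ.*-identityʳ z

range-suc : ∀ m → range 1 (ℕ.suc m) ≡ range 1 m ++ [ ℕ.suc m ]
range-suc m = sym (applyUpTo-∷ʳ ℕ.suc m)

-- A range grows at its end while `pairs` recurses at the front; symmetry of `f` permits moving the
-- new last entry to the front.
∏∏range≡pairs : (f : ℕ → ℕ → ℤ) → (∀ i j → f i j ≡ f j i) → ∀ m →
  ∏ (range 1 m) (λ j → ∏ (range 1 (j ℕ.∸ 1)) (λ i → f i j)) ≡ pairs f (range 1 m)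
∏∏range≡pairs f f-sym ℕ.zero    = refl
∏∏range≡pairs f f-sym (ℕ.suc m) = begin
  ∏ (range 1 (ℕ.suc m)) inner                     ≡⟨ cong (λ l → ∏ l inner) (range-suc m) ⟩
  ∏ (range 1 m ++ [ ℕ.suc m ]) inner              ≡⟨ ∏-++ inner (range 1 m) _ ⟩
  ∏ (range 1 m) inner * (inner (ℕ.suc m) * 1ℤ)    ≡⟨ cong₂ _*_ (∏∏range≡pairs f f-sym m) (ℤ.*-identityʳ _) ⟩
  pairs f (range 1 m) * inner (ℕ.suc m)           ≡⟨ ℤ.*-comm (pairs f (range 1 m)) _ ⟩
  inner (ℕ.suc m) * pairs f (range 1 m)           ≡⟨ cong (_* pairs f (range 1 m)) (∏-cong (λ i → f-sym i (ℕ.suc m)) (range 1 m)) ⟩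
  pairs f (ℕ.suc m ∷ range 1 m)                   ≡⟨ pairs-↭ f f-sym (∷↭∷ʳ (ℕ.suc m) (range 1 m)) ⟩
  pairs f (range 1 m ++ [ ℕ.suc m ])              ≡⟨ cong (pairs f) (range-suc m) ⟨
  pairs f (range 1 (ℕ.suc m))                     ∎
  where
  open ≡-Reasoning
  inner : ℕ → ℤ
  inner j = ∏ (range 1 (j ℕ.∸ 1)) (λ i → f i j)

pos-^ : ∀ m k → + (m ℕ.^ k) ≡ (+ m) ^ k
pos-^ m ℕ.zero    = refl
pos-^ m (ℕ.suc k) = trans (ℤ.pos-* m _) (cong (+ m *_) (pos-^ m k))

-- Congruence of integers modulo p.

module Congruence (p : ℕ) where

  infix 4 _≋_

  -- An equation with explicit quotient, so that matching on `refl` turns each closure property into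
  -- a polynomial identity for the ring solver. `≋⇒∣` and `∣⇒≋` translate to and from divisibility.
  record _≋_ (a b : ℤ) : Set where
    constructor _because_
    field
      quotient : ℤ
      equality : a ≡ b ℤ.+ quotient * + p

  ≋-refl : ∀ {a} → a ≋ a
  ≋-refl {a} = 0ℤ because sym (ℤ.+-identityʳ a)

  ≋-reflexive : ∀ {a b} → a ≡ b → a ≋ b
  ≋-reflexive refl = ≋-refl

  ≋-sym : ∀ {a b} → a ≋ b → b ≋ a
  ≋-sym {b = b} (k because refl) = (- k) because lemma b k (+ p)
    where
    lemma : ∀ b k p → b ≡ (b ℤ.+ k * p) ℤ.+ (- k) * p
    lemma = solve-∀

  ≋-trans : ∀ {a b c} → a ≋ b → b ≋ c → a ≋ c
  ≋-trans {c = c} (k because refl) (l because refl) = (l ℤ.+ k) because lemma c k l (+ p)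
    where
    lemma : ∀ c k l p → (c ℤ.+ l * p) ℤ.+ k * p ≡ c ℤ.+ (l ℤ.+ k) * p
    lemma = solve-∀

  ≋-setoid : Setoid 0ℓ 0ℓ
  ≋-setoid = record
    { Carrier       = ℤ
    ; _≈_           = _≋_
    ; isEquivalence = record { refl = ≋-refl ; sym = ≋-sym ; trans = ≋-trans }
    }

  +-cong : ∀ {a b c d} → a ≋ b → c ≋ d → a ℤ.+ c ≋ b ℤ.+ d
  +-cong {b = b} {d = d} (k because refl) (l because refl) = (k ℤ.+ l) because lemma b d k l (+ p)
    where
    lemma : ∀ b d k l p → (b ℤ.+ k * p) ℤ.+ (d ℤ.+ l * p) ≡ (b ℤ.+ d) ℤ.+ (k ℤ.+ l) * p
    lemma = solve-∀

  *-cong : ∀ {a b c d} → a ≋ b → c ≋ d → a * c ≋ b * d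
  *-cong {b = b} {d = d} (k because refl) (l because refl) =
    (k * d ℤ.+ b * l ℤ.+ k * l * + p) because lemma b d k l (+ p)
    where
    lemma : ∀ b d k l p →
      (b ℤ.+ k * p) * (d ℤ.+ l * p) ≡ b * d ℤ.+ (k * d ℤ.+ b * l ℤ.+ k * l * p) * p
    lemma = solve-∀

  neg-cong : ∀ {a b} → a ≋ b → - a ≋ - b
  neg-cong {b = b} (k because refl) = (- k) because lemma b k (+ p)
    where
    lemma : ∀ b k p → - (b ℤ.+ k * p) ≡ - b ℤ.+ (- k) * p
    lemma = solve-∀

  sub-cong : ∀ {a b c d} → a ≋ b → c ≋ d → a - c ≋ b - d
  sub-cong a≋b c≋d = +-cong a≋b (neg-cong c≋d)

  ^-cong : ∀ {a b} k → a ≋ b → a ^ k ≋ b ^ k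
  ^-cong ℕ.zero    a≋b = ≋-refl
  ^-cong (ℕ.suc k) a≋b = *-cong a≋b (^-cong k a≋b)

  module ≋-Reasoning where
    open import Relation.Binary.Reasoning.Setoid ≋-setoid public

  a-b≋0⇒a≋b : ∀ {a b} → a - b ≋ 0ℤ → a ≋ b
  a-b≋0⇒a≋b {a} {b} a-b≋0 =
    ≋-trans (≋-reflexive (split a b)) (≋-trans (+-cong a-b≋0 ≋-refl) (≋-reflexive (ℤ.+-identityˡ b)))
    where
    split : ∀ a b → a ≡ (a - b) ℤ.+ b
    split = solve-∀

  a≋b⇒a-b≋0 : ∀ {a b} → a ≋ b → a - b ≋ 0ℤ
  a≋b⇒a-b≋0 {a} {b} a≋b = ≋-trans (sub-cong a≋b (≋-refl {b})) (≋-reflexive (ℤ.+-inverseʳ b))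

  ≋⇒∣ : ∀ {a b} → a ≋ b → p ∣ ℤ.∣ a - b ∣
  ≋⇒∣ {b = b} (k because refl) = ∣⇒∣ᵤ {+ p} (Signed.divides k (cancel b (k * + p)))
    where
    cancel : ∀ b c → (b ℤ.+ c) - b ≡ c
    cancel = solve-∀

  ∣⇒≋ : ∀ {a b} → p ∣ ℤ.∣ a - b ∣ → a ≋ b
  ∣⇒≋ {a} {b} p∣a-b with Signed.divides k a-b≡kp ← ∣ᵤ⇒∣ {+ p} {a - b} p∣a-b =
    a-b≋0⇒a≋b (k because trans a-b≡kp (sym (ℤ.+-identityˡ _)))

  ≋0⇒∣ : ∀ {a} → a ≋ 0ℤ → p ∣ ℤ.∣ a ∣
  ≋0⇒∣ {a} a≋0 = subst (λ z → p ∣ ℤ.∣ z ∣) (ℤ.+-identityʳ a) (≋⇒∣ a≋0)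

  ∣⇒≋0 : ∀ {a} → p ∣ ℤ.∣ a ∣ → a ≋ 0ℤ
  ∣⇒≋0 {a} p∣a = ∣⇒≋ (subst (λ z → p ∣ ℤ.∣ z ∣) (sym (ℤ.+-identityʳ a)) p∣a)

  ∏-≋ : {f g : A → ℤ} → ∀ xs → (∀ {x} → x ∈ xs → f x ≋ g x) → ∏ xs f ≋ ∏ xs g
  ∏-≋ []       f≋g = ≋-refl
  ∏-≋ (x ∷ xs) f≋g = *-cong (f≋g (here refl)) (∏-≋ xs (f≋g ∘ there))

  -- In every use `R` is `<` on an increasing list, so the factorwise congruence need only be proved
  -- for x < y.
  pairs-≋ : {f g : A → A → ℤ} {R : A → A → Set} {xs : List A} → AllPairs R xs →
    (∀ {x y} → x ∈ xs → y ∈ xs → R x y → f x y ≋ g x y) → pairs f xs ≋ pairs g xs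
  pairs-≋ []                   f≋g = ≋-refl
  pairs-≋ {xs = x ∷ xs} (Rx ∷ Rxs) f≋g = *-cong
    (∏-≋ xs λ y∈xs → f≋g (here refl) (there y∈xs) (All.lookup Rx y∈xs))
    (pairs-≋ Rxs (λ x∈xs y∈xs → f≋g (there x∈xs) (there y∈xs)))

  module _ .{{_ : NonZero p}} where

    %-≋ : ∀ x → + (x % p) ≋ + x
    %-≋ x = ≋-sym ((+ (x / p)) because
      trans (cong +_ (m≡m%n+[m/n]*n x p)) (trans (ℤ.pos-+ (x % p) _) (cong (λ z → + (x % p) ℤ.+ z) (ℤ.pos-* (x / p) p))))

    <p∧∣⇒≡0 : ∀ {x} → x ℕ.< p → p ∣ x → x ≡ 0
    <p∧∣⇒≡0 {ℕ.zero}  x<p p∣x = refl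
    <p∧∣⇒≡0 {ℕ.suc x} x<p p∣x = contradiction p∣x (>⇒∤ x<p)

    -- The difference has absolute value at most max(x, y) < p, and the only multiple of p that
    -- small is 0.
    ≋⇒≡ : ∀ {x y} → x ℕ.< p → y ℕ.< p → + x ≋ + y → x ≡ y
    ≋⇒≡ {x} {y} x<p y<p x≋y = ℤ.+-injective (ℤ.i-j≡0⇒i≡j (+ x) (+ y) (ℤ.∣i∣≡0⇒i≡0
      (<p∧∣⇒≡0 (ℕ.≤-<-trans ∣x-y∣≤x⊔y (ℕ.⊔-lub x<p y<p)) (≋⇒∣ x≋y))))
      where
      ∣x-y∣≤x⊔y : ℤ.∣ + x - + y ∣ ℕ.≤ x ℕ.⊔ y
      ∣x-y∣≤x⊔y = subst (ℕ._≤ x ℕ.⊔ y) (cong ℤ.∣_∣ (sym (ℤ.m-n≡m⊖n x y))) (ℤ.∣m⊝n∣≤m⊔n x y)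

    ≋⇒%≡% : ∀ {x y} → + x ≋ + y → x % p ≡ y % p
    ≋⇒%≡% {x} {y} x≋y = ≋⇒≡ (m%n<n x p) (m%n<n y p)
      (≋-trans (%-≋ x) (≋-trans x≋y (≋-sym (%-≋ y))))

    %≡%⇒≋ : ∀ {x y} → x % p ≡ y % p → + x ≋ + y
    %≡%⇒≋ {x} {y} eq = ≋-trans (≋-sym (%-≋ x)) (≋-trans (≋-reflexive (cong +_ eq)) (%-≋ y))

  module _ (p-prime : Prime p) where

    *≋0 : ∀ a {b} → a * b ≋ 0ℤ → a ≋ 0ℤ ⊎ b ≋ 0ℤ
    *≋0 a {b} ab≋0 = Sum.map ∣⇒≋0 ∣⇒≋0
      (euclidsLemma ℤ.∣ a ∣ ℤ.∣ b ∣ p-prime (subst (p ∣_) (ℤ.abs-* a b) (≋0⇒∣ ab≋0)))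

    *-cancelˡ : ∀ a {b c} → ¬ a ≋ 0ℤ → a * b ≋ a * c → b ≋ c
    *-cancelˡ a {b} {c} a≢0 ab≋ac with *≋0 a (≋-trans (≋-reflexive (distrib a b c)) (a≋b⇒a-b≋0 ab≋ac))
      where
      distrib : ∀ a b c → a * (b - c) ≡ a * b - a * c
      distrib = solve-∀
    ... | inj₁ a≋0   = contradiction a≋0 a≢0
    ... | inj₂ b-c≋0 = a-b≋0⇒a≋b b-c≋0

    squares≋ : ∀ a b → a * a ≋ b * b → a ≋ b ⊎ a ≋ - b
    squares≋ a b a²≋b² = Sum.map a-b≋0⇒a≋b
      (λ a+b≋0 → a-b≋0⇒a≋b (≋-trans (≋-reflexive (cong (λ z → a ℤ.+ z) (ℤ.neg-involutive b))) a+b≋0))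
      (*≋0 (a - b) (≋-trans (≋-reflexive (factor a b)) (a≋b⇒a-b≋0 a²≋b²)))
      where
      factor : ∀ a b → (a - b) * (a ℤ.+ b) ≡ a * a - b * b
      factor = solve-∀

-- Duplicate-free lists, ranges, and products of powers.

-- Without repetitions a list is determined up to order by its set of entries. Each bijection of the
-- argument becomes a reindexing of a product in this way.
unique-↭ : {xs ys : List A} → Unique xs → Unique ys →
  (∀ {z} → z ∈ xs → z ∈ ys) → (∀ {z} → z ∈ ys → z ∈ xs) → xs ↭ ys
unique-↭ xs! ys! xs⊆ys ys⊆xs = ∼bag⇒↭ (unique∧set⇒bag xs! ys! (mk⇔ xs⊆ys ys⊆xs))

AllPairs-∈-map : {R S : A → A → Set} {xs : List A} →
  (∀ {x y} → x ∈ xs → y ∈ xs → R x y → S x y) → AllPairs R xs → AllPairs S xs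
AllPairs-∈-map R⇒S []         = []
AllPairs-∈-map R⇒S (Rx ∷ Rxs) =
  All.tabulate (λ y∈xs → R⇒S (here refl) (there y∈xs) (All.lookup Rx y∈xs)) ∷
  AllPairs-∈-map (λ x∈xs y∈xs → R⇒S (there x∈xs) (there y∈xs)) Rxs

∈-range⁻ : ∀ {x m} → x ∈ range 1 m → 1 ℕ.≤ x × x ℕ.≤ m
∈-range⁻ x∈ with _ , i<m , refl ← ∈-applyUpTo⁻ ℕ.suc x∈ = ℕ.s≤s ℕ.z≤n , i<m

∈-range⁺ : ∀ {x m} → 1 ℕ.≤ x → x ℕ.≤ m → x ∈ range 1 m
∈-range⁺ {ℕ.suc x} _ x<m = ∈-applyUpTo⁺ ℕ.suc x<m

range-increasing : ∀ m → AllPairs ℕ._<_ (range 1 m)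
range-increasing m = AllPairs.applyUpTo⁺₁ ℕ.suc m (λ i<j _ → ℕ.s<s i<j)

range-unique : ∀ m → Unique (range 1 m)
range-unique m = applyUpTo⁺₁ ℕ.suc m (λ i<j _ → ℕ.<⇒≢ (ℕ.s<s i<j))

!≡∏ : ∀ m → + (m !) ≡ ∏ (range 1 m) (λ x → + x)
!≡∏ ℕ.zero    = refl
!≡∏ (ℕ.suc m) = begin
  + (ℕ.suc m ℕ.* m !)                    ≡⟨ ℤ.pos-* (ℕ.suc m) (m !) ⟩
  + ℕ.suc m * + (m !)                    ≡⟨ cong (+ ℕ.suc m *_) (!≡∏ m) ⟩
  + ℕ.suc m * ∏ (range 1 m) (λ x → + x)           ≡⟨ ℤ.*-comm (+ ℕ.suc m) _ ⟩
  ∏ (range 1 m) (λ x → + x) * + ℕ.suc m           ≡⟨ cong (∏ (range 1 m) (λ x → + x) *_) (ℤ.*-identityʳ _) ⟨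
  ∏ (range 1 m) (λ x → + x) * ∏ [ ℕ.suc m ] (λ x → + x)    ≡⟨ ∏-++ (λ x → + x) (range 1 m) _ ⟨
  ∏ (range 1 m ++ [ ℕ.suc m ]) (λ x → + x)        ≡⟨ cong (λ l → ∏ l (λ x → + x)) (range-suc m) ⟨
  ∏ (range 1 (ℕ.suc m)) (λ x → + x)               ∎
  where open ≡-Reasoning

-- The exponents 2k for k < m add up to m² - m; the extra factor c^m avoids the subtraction.
∏-squared-powers : ∀ c m → ∏ (upTo m) (λ k → c ^ k * c ^ k) * c ^ m ≡ c ^ (m ℕ.* m)
∏-squared-powers c ℕ.zero    = refl
∏-squared-powers c (ℕ.suc m) = begin
  ∏ (upTo (ℕ.suc m)) f * c ^ ℕ.suc m                  ≡⟨ cong (λ l → ∏ l f * c ^ ℕ.suc m) (upTo-∷ʳ m) ⟨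
  ∏ (upTo m ++ [ m ]) f * c ^ ℕ.suc m                 ≡⟨ cong (_* c ^ ℕ.suc m) (∏-++ f (upTo m) [ m ]) ⟩
  (∏ (upTo m) f * (f m * 1ℤ)) * (c * c ^ m)           ≡⟨ rearrange (∏ (upTo m) f) c (c ^ m) ⟩
  (∏ (upTo m) f * c ^ m) * (c ^ m * (c * c ^ m))      ≡⟨ cong (_* (c ^ m * (c * c ^ m))) (∏-squared-powers c m) ⟩
  c ^ (m ℕ.* m) * (c ^ m * c ^ ℕ.suc m)               ≡⟨ cong (c ^ (m ℕ.* m) *_) (ℤ.^-distribˡ-+-* c m (ℕ.suc m)) ⟨
  c ^ (m ℕ.* m) * c ^ (m + ℕ.suc m)                   ≡⟨ ℤ.^-distribˡ-+-* c (m ℕ.* m) _ ⟨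
  c ^ (m ℕ.* m + (m + ℕ.suc m))                       ≡⟨ cong (c ^_) (square-suc m) ⟩
  c ^ (ℕ.suc m ℕ.* ℕ.suc m)                           ∎
  where
  open ≡-Reasoning
  f : ℕ → ℤ
  f k = c ^ k * c ^ k
  rearrange : ∀ a c x → (a * (x * x * 1ℤ)) * (c * x) ≡ (a * x) * (x * (c * x))
  rearrange = solve-∀
  square-suc : ∀ m → m ℕ.* m + (m + ℕ.suc m) ≡ ℕ.suc m ℕ.* ℕ.suc m
  square-suc = ℕ-solve-∀

neg*neg : ∀ a → (- a) * (- a) ≡ a * a
neg*neg = solve-∀

□ : ℕ → ℤ
□ x = + (x ℕ.* x)

□≡* : ∀ x → □ x ≡ + x * + x
□≡* x = ℤ.pos-* x x

-- The half system {1, ..., 2n} and absolute least residues for p = 4n + 1.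

module HalfSystem (p n : ℕ) .{{_ : NonZero p}} (p-prime : Prime p) (p≡1+4n : p ≡ ℕ.suc (4 ℕ.* n)) where

  open Congruence p

  p∸1≡4n : p ℕ.∸ 1 ≡ 4 ℕ.* n
  p∸1≡4n = cong (ℕ._∸ 1) p≡1+4n

  half≡2n : half p ≡ 2 ℕ.* n
  half≡2n = trans (cong (_/ 2) (trans p∸1≡4n (double n))) (m*n/n≡m (2 ℕ.* n) 2)
    where
    double : ∀ n → 4 ℕ.* n ≡ 2 ℕ.* n ℕ.* 2
    double = ℕ-solve-∀

  quarter≡n : quarter p ≡ n
  quarter≡n = trans (cong (_/ 4) (trans p∸1≡4n (ℕ.*-comm 4 n))) (m*n/n≡m n 4)

  1<p : 1 ℕ.< p
  1<p = ℕ.nonTrivial⇒n>1 p {{prime⇒nonTrivial p-prime}}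

  0<n : 0 ℕ.< n
  0<n = ℕ.n≢0⇒n>0 λ n≡0 → ℕ.<⇒≢ 1<p (sym (trans p≡1+4n (cong (λ m → ℕ.suc (4 ℕ.* m)) n≡0)))

  4n<p : 4 ℕ.* n ℕ.< p
  4n<p = ℕ.≤-reflexive (sym p≡1+4n)

  2n+2n≡4n : 2 ℕ.* n + 2 ℕ.* n ≡ 4 ℕ.* n
  2n+2n≡4n = sym (ℕ.*-distribʳ-+ n 2 2)

  2n≤4n : 2 ℕ.* n ℕ.≤ 4 ℕ.* n
  2n≤4n = ℕ.*-monoˡ-≤ n {2} {4} (ℕ.s≤s (ℕ.s≤s ℕ.z≤n))

  2<p : 2 ℕ.< p
  2<p = ℕ.≤-<-trans (ℕ.≤-trans (ℕ.s≤s (ℕ.s≤s ℕ.z≤n)) (ℕ.*-monoʳ-≤ 4 0<n)) 4n<p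

  <p⇒≢0 : ∀ {x} → 0 ℕ.< x → x ℕ.< p → ¬ + x ≋ 0ℤ
  <p⇒≢0 0<x x<p x≋0 = ℕ.<⇒≢ 0<x (sym (≋⇒≡ x<p (ℕ.<-trans ℕ.z<s 1<p) x≋0))

  1≢0 : ¬ 1ℤ ≋ 0ℤ
  1≢0 = <p⇒≢0 ℕ.z<s 1<p

  2≢0 : ¬ + 2 ≋ 0ℤ
  2≢0 = <p⇒≢0 ℕ.z<s 2<p

  residue-positive : ∀ {x} → ¬ + x ≋ 0ℤ → 0 ℕ.< x % p
  residue-positive {x} x≢0 = ℕ.n≢0⇒n>0 λ x%p≡0 →
    x≢0 (≋-trans (≋-sym (%-≋ x)) (≋-reflexive (cong (λ x → + x) x%p≡0)))

  record InHalf (x : ℕ) : Set where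
    constructor _,_
    field
      positive : 0 ℕ.< x
      bounded  : x ℕ.≤ 2 ℕ.* n

  ∈⇒InHalf : ∀ {x} → x ∈ range 1 (half p) → InHalf x
  ∈⇒InHalf {x} x∈ with 0<x , x≤half ← ∈-range⁻ x∈ = 0<x , subst (x ℕ.≤_) half≡2n x≤half

  InHalf⇒∈ : ∀ {x} → InHalf x → x ∈ range 1 (half p)
  InHalf⇒∈ {x} (0<x , x≤2n) = ∈-range⁺ 0<x (subst (x ℕ.≤_) (sym half≡2n) x≤2n)

  InHalf⇒<p : ∀ {x} → InHalf x → x ℕ.< p
  InHalf⇒<p (_ , x≤2n) = ℕ.≤-<-trans (ℕ.≤-trans x≤2n 2n≤4n) 4n<p

  InHalf⇒≢0 : ∀ {x} → InHalf x → ¬ + x ≋ 0ℤ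
  InHalf⇒≢0 x∈H = <p⇒≢0 (InHalf.positive x∈H) (InHalf⇒<p x∈H)

  InHalf⇒□≢0 : ∀ {x} → InHalf x → ¬ □ x ≋ 0ℤ
  InHalf⇒□≢0 {x} x∈H □x≋0 = [ InHalf⇒≢0 x∈H , InHalf⇒≢0 x∈H ]′
    (*≋0 p-prime (+ x) (≋-trans (≋-reflexive (sym (□≡* x))) □x≋0))

  -- The alternative x ≡ -y is impossible because 0 < x + y ≤ 4n < p. Equalities inside {1, ..., 2n}
  -- can therefore be checked on squares, where the sign choice of `tilde` disappears.
  □-injective : ∀ {x y} → InHalf x → InHalf y → □ x ≋ □ y → x ≡ y
  □-injective {x} {y} x∈H y∈H □x≋□y
    with squares≋ p-prime (+ x) (+ y)
           (≋-trans (≋-reflexive (sym (□≡* x))) (≋-trans □x≋□y (≋-reflexive (□≡* y))))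
  ... | inj₁ x≋y  = ≋⇒≡ (InHalf⇒<p x∈H) (InHalf⇒<p y∈H) x≋y
  ... | inj₂ x≋-y = contradiction x+y≋0 (<p⇒≢0 (ℕ.+-mono-≤ (InHalf.positive x∈H) ℕ.z≤n) x+y<p)
    where
    x+y≋0 : + (x + y) ≋ 0ℤ
    x+y≋0 = ≋-trans (≋-reflexive (ℤ.pos-+ x y))
      (≋-trans (+-cong x≋-y (≋-refl {+ y})) (≋-reflexive (ℤ.+-inverseˡ (+ y))))
    x+y<p : x + y ℕ.< p
    x+y<p = ℕ.≤-<-trans (ℕ.+-mono-≤ (InHalf.bounded x∈H) (InHalf.bounded y∈H))
      (subst (ℕ._< p) (sym 2n+2n≡4n) 4n<p)

  tilde-InHalf : ∀ x → ¬ + x ≋ 0ℤ → InHalf (tilde p x)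
  tilde-InHalf x x≢0 with p ℕ.<? 2 ℕ.* (x % p)
  ... | yes p<2r = ℕ.m<n⇒0<n∸m (m%n<n x p) , subst (p ℕ.∸ x % p ℕ.≤_) p∸[1+2n]≡2n (ℕ.∸-monoʳ-≤ p 2n<r)
    where
    2n<r : 2 ℕ.* n ℕ.< x % p
    2n<r = ℕ.*-cancelˡ-< 2 _ _ (ℕ.≤-<-trans (ℕ.≤-reflexive (sym (ℕ.*-assoc 2 2 n))) (ℕ.<-trans 4n<p p<2r))
    split : ∀ n → ℕ.suc (4 ℕ.* n) ≡ ℕ.suc (2 ℕ.* n) + 2 ℕ.* n
    split = ℕ-solve-∀
    p∸[1+2n]≡2n : p ℕ.∸ ℕ.suc (2 ℕ.* n) ≡ 2 ℕ.* n
    p∸[1+2n]≡2n = trans (cong (ℕ._∸ ℕ.suc (2 ℕ.* n)) (trans p≡1+4n (split n)))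
      (ℕ.m+n∸m≡n (ℕ.suc (2 ℕ.* n)) (2 ℕ.* n))
  ... | no p≮2r = residue-positive x≢0 , ℕ.≮⇒≥ λ 2n<r → p≮2r
    (subst (ℕ._< 2 ℕ.* (x % p)) (sym p≡1+4n)
      (ℕ.<-≤-trans (ℕ.≤-reflexive (double n)) (ℕ.*-monoʳ-≤ 2 2n<r)))
    where
    double : ∀ n → ℕ.suc (ℕ.suc (4 ℕ.* n)) ≡ 2 ℕ.* ℕ.suc (2 ℕ.* n)
    double = ℕ-solve-∀

  □-tilde : ∀ x → □ (tilde p x) ≋ □ x
  □-tilde x with p ℕ.<? 2 ℕ.* (x % p)
  ... | no  _ = ≋-trans (≋-reflexive (□≡* (x % p)))
    (≋-trans (*-cong (%-≋ x) (%-≋ x)) (≋-reflexive (sym (□≡* x))))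
  ... | yes _ = begin
    □ (p ℕ.∸ x % p)                    ≡⟨ □≡* (p ℕ.∸ x % p) ⟩
    + (p ℕ.∸ x % p) * + (p ℕ.∸ x % p)  ≈⟨ *-cong p∸r≋-x p∸r≋-x ⟩
    (- + x) * (- + x)                  ≡⟨ neg*neg (+ x) ⟩
    + x * + x                          ≡⟨ □≡* x ⟨
    □ x                                ∎
    where
    open ≋-Reasoning
    p≋0 : + p ≋ 0ℤ
    p≋0 = 1ℤ because sym (trans (ℤ.+-identityˡ _) (ℤ.*-identityˡ _))
    p∸r≋-x : + (p ℕ.∸ x % p) ≋ - + x
    p∸r≋-x = begin
      + (p ℕ.∸ x % p)   ≡⟨ ℤ.⊖-≥ (ℕ.<⇒≤ (m%n<n x p)) ⟨
      p ℤ.⊖ (x % p)     ≡⟨ ℤ.m-n≡m⊖n p (x % p) ⟨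
      + p - + (x % p)   ≈⟨ sub-cong p≋0 (%-≋ x) ⟩
      0ℤ - + x          ≡⟨ ℤ.+-identityˡ _ ⟩
      - + x             ∎

  -- Powers of the primitive root, discrete logarithms, and the square of t.

  module Powers (g : ℕ) (g-primitive : IsPrimitiveRoot p g) where

    γ : ℤ
    γ = + g

    γ^[4n]≋1 : γ ^ (4 ℕ.* n) ≋ 1ℤ
    γ^[4n]≋1 = ≋-trans (≋-reflexive (sym (pos-^ g (4 ℕ.* n))))
      (%≡%⇒≋ (subst (λ k → (g ℕ.^ k) % p ≡ 1 % p) p∸1≡4n (proj₁ g-primitive)))

    γ^≢1 : ∀ {k} → 0 ℕ.< k → k ℕ.< 4 ℕ.* n → ¬ γ ^ k ≋ 1ℤ
    γ^≢1 {k} 0<k k<4n γ^k≋1 = proj₂ g-primitive k 0<k (subst (k ℕ.<_) (sym p∸1≡4n) k<4n)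
      (≋⇒%≡% (≋-trans (≋-reflexive (pos-^ g k)) γ^k≋1))

    γ^≢0 : ∀ k → ¬ γ ^ k ≋ 0ℤ
    γ^≢0 k γ^k≋0 = 1≢0 (begin
      1ℤ                                   ≡⟨ ℤ.^-zeroˡ k ⟨
      1ℤ ^ k                               ≈⟨ ^-cong k γ^[4n]≋1 ⟨
      (γ ^ (4 ℕ.* n)) ^ k                  ≡⟨ ℤ.^-*-assoc γ (4 ℕ.* n) k ⟩
      γ ^ (4 ℕ.* n ℕ.* k)                  ≡⟨ cong (γ ^_) (ℕ.*-comm (4 ℕ.* n) k) ⟩
      γ ^ (k ℕ.* (4 ℕ.* n))                ≡⟨ ℤ.^-*-assoc γ k (4 ℕ.* n) ⟨
      (γ ^ k) ^ (4 ℕ.* n)                  ≈⟨ ^-cong (4 ℕ.* n) γ^k≋0 ⟩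
      -- The exponent must be positive here, since `0ℤ ^ 0` is 1.
      0ℤ ^ (4 ℕ.* n)                       ≡⟨ 0^ (ℕ.*-monoʳ-≤ 4 0<n) ⟩
      0ℤ                                   ∎)
      where
      open ≋-Reasoning
      0^ : ∀ {m} → 4 ℕ.≤ m → 0ℤ ^ m ≡ 0ℤ
      0^ (ℕ.s≤s _) = refl

    -- Dividing by γ^i leaves a power with exponent strictly between 0 and 4n. The exponents lie in
    -- an arbitrary window of length 4n because the exponents 4r on the right-hand side run up to 4n
    -- itself.
    γ^-injective : ∀ {i j} → i ℕ.< j → j ℕ.< i + 4 ℕ.* n → ¬ γ ^ i ≋ γ ^ j
    γ^-injective {i} {j} i<j j<i+4n γ^i≋γ^j = γ^≢1 (ℕ.m<n⇒0<n∸m i<j)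
      (subst (j ℕ.∸ i ℕ.<_) (ℕ.m+n∸m≡n i _) (ℕ.∸-monoˡ-< j<i+4n (ℕ.<⇒≤ i<j)))
      (≋-sym (*-cancelˡ p-prime (γ ^ i) (γ^≢0 i) (begin
        γ ^ i * 1ℤ             ≡⟨ ℤ.*-identityʳ _ ⟩
        γ ^ i                  ≈⟨ γ^i≋γ^j ⟩
        γ ^ j                  ≡⟨ cong (γ ^_) (ℕ.m+[n∸m]≡n (ℕ.<⇒≤ i<j)) ⟨
        γ ^ (i + (j ℕ.∸ i))    ≡⟨ ℤ.^-distribˡ-+-* γ i _ ⟩
        γ ^ i * γ ^ (j ℕ.∸ i)  ∎)))
      where open ≋-Reasoning

    γ^[2n]≋-1 : γ ^ (2 ℕ.* n) ≋ -1ℤ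
    γ^[2n]≋-1 = [ (λ γ^[2n]≋1 → contradiction γ^[2n]≋1 (γ^≢1 0<2n 2n<4n)) , (λ eq → eq) ]′
      (squares≋ p-prime (γ ^ (2 ℕ.* n)) 1ℤ (begin
        γ ^ (2 ℕ.* n) * γ ^ (2 ℕ.* n)  ≡⟨ ℤ.^-distribˡ-+-* γ (2 ℕ.* n) _ ⟨
        γ ^ (2 ℕ.* n + 2 ℕ.* n)        ≡⟨ cong (γ ^_) 2n+2n≡4n ⟩
        γ ^ (4 ℕ.* n)                  ≈⟨ γ^[4n]≋1 ⟩
        1ℤ * 1ℤ                        ∎))
      where
      open ≋-Reasoning
      0<2n : 0 ℕ.< 2 ℕ.* n
      0<2n = ℕ.≤-trans 0<n (ℕ.m≤m+n n _)
      2n<4n : 2 ℕ.* n ℕ.< 4 ℕ.* n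
      2n<4n = ℕ.*-monoˡ-< n {{ℕ.>-nonZero 0<n}} {2} {4} (ℕ.s<s (ℕ.s<s ℕ.z<s))

    g^≢0 : ∀ k → ¬ + (g ℕ.^ k) ≋ 0ℤ
    g^≢0 k g^k≋0 = γ^≢0 k (≋-trans (≋-reflexive (sym (pos-^ g k))) g^k≋0)

    -- Primitivity supplies only distinct powers; surjectivity comes from counting. Among x and the
    -- 4n powers g⁰, ..., g⁴ⁿ⁻¹ two must share one of the 4n nonzero residues, and two powers never
    -- do, so x meets a power.
    discrete-log : ∀ x → ¬ + x ≋ 0ℤ → ∃ λ k → k ℕ.< 4 ℕ.* n × + x ≋ γ ^ k
    discrete-log x x≢0 = collision (pigeonhole (ℕ.n<1+n _) f)
      where
      -- Nonzero residues run over 1, ..., 4n; the predecessor shifts them onto `Fin (4 ℕ.* n)`.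
      bound : ∀ y → ¬ + y ≋ 0ℤ → ℕ.pred (y % p) ℕ.< 4 ℕ.* n
      bound y y≢0 = subst (ℕ.pred (y % p) ℕ.<_) p∸1≡4n
        (ℕ.pred-mono-< {{ℕ.>-nonZero (residue-positive y≢0)}} (m%n<n y p))

      index : ∀ y → ¬ + y ≋ 0ℤ → Fin (4 ℕ.* n)
      index y y≢0 = fromℕ< (bound y y≢0)

      index-injective : ∀ {y z} (y≢0 : ¬ + y ≋ 0ℤ) (z≢0 : ¬ + z ≋ 0ℤ) → index y y≢0 ≡ index z z≢0 → + y ≋ + z
      index-injective {y} {z} y≢0 z≢0 eq = %≡%⇒≋
        (ℕ.pred-injective {{ℕ.>-nonZero (residue-positive y≢0)}} {{ℕ.>-nonZero (residue-positive z≢0)}}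
          (fromℕ<-injective _ _ (bound y y≢0) (bound z z≢0) eq))

      f : Fin (ℕ.suc (4 ℕ.* n)) → Fin (4 ℕ.* n)
      f Fin.zero    = index x x≢0
      f (Fin.suc k) = index (g ℕ.^ toℕ k) (g^≢0 (toℕ k))

      collision : (∃ λ i → ∃ λ j → i Fin.< j × f i ≡ f j) → ∃ λ k → k ℕ.< 4 ℕ.* n × + x ≋ γ ^ k
      collision (Fin.zero , Fin.suc k , _ , eq) =
        toℕ k , toℕ<n k , ≋-trans (index-injective x≢0 (g^≢0 (toℕ k)) eq) (≋-reflexive (pos-^ g (toℕ k)))
      collision (Fin.suc k , Fin.suc l , k<l , eq) = contradiction
        (≋-trans (≋-reflexive (sym (pos-^ g (toℕ k))))
          (≋-trans (index-injective (g^≢0 (toℕ k)) (g^≢0 (toℕ l)) eq) (≋-reflexive (pos-^ g (toℕ l)))))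
        (γ^-injective (ℕ.s<s⁻¹ k<l) (ℕ.<-≤-trans (toℕ<n l) (ℕ.m≤n+m _ (toℕ k))))

    □-g^ : ∀ k → □ (g ℕ.^ k) ≡ γ ^ k * γ ^ k
    □-g^ k = trans (□≡* (g ℕ.^ k)) (cong (λ z → z * z) (pos-^ g k))

    -- The squares γ^(2k) with k < 2n are distinct, hence so are the absolute residues of gᵏ.
    -- Conversely γ^(2n) ≡ -1 folds an exponent of at least 2n back below 2n at the cost of a sign,
    -- and squaring removes it.
    half↭tilde-powers : map (λ k → tilde p (g ℕ.^ k)) (upTo (2 ℕ.* n)) ↭ range 1 (half p)
    half↭tilde-powers = unique-↭ unique (range-unique (half p)) ⊆-half half-⊆
      where
      τ : ℕ → ℕ
      τ k = tilde p (g ℕ.^ k)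

      τ-square : ∀ k → □ (τ k) ≋ γ ^ (2 ℕ.* k)
      τ-square k = ≋-trans (□-tilde (g ℕ.^ k)) (≋-reflexive (trans (□-g^ k)
        (trans (sym (ℤ.^-distribˡ-+-* γ k k)) (cong (γ ^_) (cong (λ m → k + m) (sym (ℕ.+-identityʳ k)))))))

      unique : Unique (map τ (upTo (2 ℕ.* n)))
      unique = AllPairs.map⁺ (AllPairs.applyUpTo⁺₁ (λ k → k) (2 ℕ.* n) λ {i} {j} i<j j<2n τi≡τj →
        γ^-injective (ℕ.*-monoʳ-< 2 i<j)
          (ℕ.<-≤-trans (subst (2 ℕ.* j ℕ.<_) (sym (ℕ.*-assoc 2 2 n)) (ℕ.*-monoʳ-< 2 j<2n)) (ℕ.m≤n+m _ (2 ℕ.* i)))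
          (≋-trans (≋-sym (τ-square i)) (≋-trans (≋-reflexive (cong □ τi≡τj)) (τ-square j))))

      ⊆-half : ∀ {z} → z ∈ map τ (upTo (2 ℕ.* n)) → z ∈ range 1 (half p)
      ⊆-half z∈ with k , _ , refl ← ∈-map⁻ τ z∈ = InHalf⇒∈ (tilde-InHalf (g ℕ.^ k) (g^≢0 k))

      τ-hits : ∀ {x k} → InHalf x → k ℕ.< 2 ℕ.* n → □ x ≋ □ (g ℕ.^ k) → x ∈ map τ (upTo (2 ℕ.* n))
      τ-hits {x} {k} x∈H k<2n □x≋ = subst (_∈ map τ (upTo (2 ℕ.* n)))
        (□-injective (tilde-InHalf (g ℕ.^ k) (g^≢0 k)) x∈H
          (≋-trans (□-tilde (g ℕ.^ k)) (≋-sym □x≋)))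
        (∈-map⁺ τ (∈-upTo⁺ k<2n))

      half-⊆ : ∀ {z} → z ∈ range 1 (half p) → z ∈ map τ (upTo (2 ℕ.* n))
      half-⊆ {x} x∈ with x∈H ← ∈⇒InHalf x∈ with k , k<4n , x≋γ^k ← discrete-log x (InHalf⇒≢0 x∈H) with k ℕ.<? 2 ℕ.* n
      ... | yes k<2n = τ-hits x∈H k<2n (≋-trans (≋-reflexive (□≡* x))
        (≋-trans (*-cong x≋γ^k x≋γ^k) (≋-reflexive (sym (□-g^ k)))))
      ... | no  k≮2n = τ-hits x∈H
        (subst (k ℕ.∸ 2 ℕ.* n ℕ.<_) (trans (cong (ℕ._∸ 2 ℕ.* n) (sym 2n+2n≡4n)) (ℕ.m+n∸m≡n (2 ℕ.* n) _))
          (ℕ.∸-monoˡ-< k<4n (ℕ.≮⇒≥ k≮2n)))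
        (begin
          □ x                                        ≡⟨ □≡* x ⟩
          + x * + x                                  ≈⟨ *-cong x≋-γ^l x≋-γ^l ⟩
          (-1ℤ * γ ^ l) * (-1ℤ * γ ^ l)              ≡⟨ signs (γ ^ l) ⟩
          γ ^ l * γ ^ l                              ≡⟨ □-g^ l ⟨
          □ (g ℕ.^ l)                                ∎)
        where
        open ≋-Reasoning
        l = k ℕ.∸ 2 ℕ.* n
        signs : ∀ a → (-1ℤ * a) * (-1ℤ * a) ≡ a * a
        signs = solve-∀
        x≋-γ^l : + x ≋ -1ℤ * γ ^ l
        x≋-γ^l = begin
          + x                      ≈⟨ x≋γ^k ⟩
          γ ^ k                    ≡⟨ cong (γ ^_) (ℕ.m+[n∸m]≡n (ℕ.≮⇒≥ k≮2n)) ⟨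
          γ ^ (2 ℕ.* n + l)        ≡⟨ ℤ.^-distribˡ-+-* γ (2 ℕ.* n) l ⟩
          γ ^ (2 ℕ.* n) * γ ^ l    ≈⟨ *-cong γ^[2n]≋-1 ≋-refl ⟩
          -1ℤ * γ ^ l              ∎

    t : ℕ
    t = tval p

    -- Up to sign, the factors of t are the gᵏ with k < 2n, so t² ≡ ∏ g²ᵏ = g^(2n(2n-1)) ≡ (-1)^(2n-1).
    □t≋-1 : □ t ≋ -1ℤ
    □t≋-1 = begin
      □ t                                    ≡⟨ □≡* t ⟩
      + t * + t                              ≡⟨ cong (λ z → z * z) (!≡∏ (half p)) ⟩
      ∏ (range 1 (half p)) (λ x → + x) * ∏ (range 1 (half p)) (λ x → + x)  ≡⟨ ∏-* (λ x → + x) (λ x → + x) (range 1 (half p)) ⟨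
      ∏ (range 1 (half p)) (λ x → + x * + x) ≡⟨ ∏-↭ (λ x → + x * + x) half↭tilde-powers ⟨
      ∏ (map τ (upTo (2 ℕ.* n))) (λ x → + x * + x) ≡⟨ ∏-map (λ x → + x * + x) τ (upTo (2 ℕ.* n)) ⟩
      ∏ (upTo (2 ℕ.* n)) (λ k → + τ k * + τ k)     ≈⟨ ∏-≋ (upTo (2 ℕ.* n)) (λ {k} _ → τ-square k) ⟩
      P                                      ≡⟨ sign P ⟩
      -1ℤ * (P * -1ℤ)                        ≈⟨ *-cong (≋-refl { -1ℤ}) (*-cong (≋-refl {P}) γ^[2n]≋-1) ⟨
      -1ℤ * (P * γ ^ (2 ℕ.* n))              ≡⟨ cong (-1ℤ *_) (∏-squared-powers γ (2 ℕ.* n)) ⟩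
      -1ℤ * γ ^ (2 ℕ.* n ℕ.* (2 ℕ.* n))      ≡⟨ cong (λ m → -1ℤ * γ ^ m) (square n) ⟩
      -1ℤ * γ ^ (4 ℕ.* n ℕ.* n)              ≡⟨ cong (-1ℤ *_) (ℤ.^-*-assoc γ (4 ℕ.* n) n) ⟨
      -1ℤ * (γ ^ (4 ℕ.* n)) ^ n              ≈⟨ *-cong (≋-refl { -1ℤ}) (^-cong n γ^[4n]≋1) ⟩
      -1ℤ * 1ℤ ^ n                           ≡⟨ cong (-1ℤ *_) (ℤ.^-zeroˡ n) ⟩
      -1ℤ                                    ∎
      where
      open ≋-Reasoning
      τ : ℕ → ℕ
      τ k = tilde p (g ℕ.^ k)
      P : ℤ
      P = ∏ (upTo (2 ℕ.* n)) (λ k → γ ^ k * γ ^ k)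
      τ-square : ∀ k → + τ k * + τ k ≋ γ ^ k * γ ^ k
      τ-square k = ≋-trans (≋-reflexive (sym (□≡* (τ k)))) (≋-trans (□-tilde (g ℕ.^ k)) (≋-reflexive (□-g^ k)))
      sign : ∀ a → a ≡ -1ℤ * (a * -1ℤ)
      sign = solve-∀
      square : ∀ n → 2 ℕ.* n ℕ.* (2 ℕ.* n) ≡ 4 ℕ.* n ℕ.* n
      square = ℕ-solve-∀

-- Triangular numbers, fourth powers, and symmetric difference factors.

-- The binomial coefficient m(m - 1)/2, defined by the recursion of `pairs` and free of truncated
-- division.
triangle : ℕ → ℕ
triangle ℕ.zero    = 0
triangle (ℕ.suc m) = m + triangle m

pairs-const : (c : ℤ) (xs : List A) → pairs (λ _ _ → c) xs ≡ c ^ triangle (length xs)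
pairs-const c []       = refl
pairs-const c (x ∷ xs) = trans (cong₂ _*_ (∏-const c xs) (pairs-const c xs))
  (sym (ℤ.^-distribˡ-+-* c (length xs) _))

∏-1 : (xs : List A) → ∏ xs (λ _ → 1ℤ) ≡ 1ℤ
∏-1 xs = trans (∏-const 1ℤ xs) (ℤ.^-zeroˡ (length xs))

2*triangle : ∀ m → 2 ℕ.* triangle (ℕ.suc m) ≡ ℕ.suc m ℕ.* m
2*triangle ℕ.zero    = refl
2*triangle (ℕ.suc m) = trans (ℕ.*-distribˡ-+ 2 (ℕ.suc m) (triangle (ℕ.suc m)))
  (trans (cong (λ k → 2 ℕ.* ℕ.suc m + k) (2*triangle m)) (step m))
  where
  step : ∀ m → 2 ℕ.* ℕ.suc m + ℕ.suc m ℕ.* m ≡ ℕ.suc (ℕ.suc m) ℕ.* ℕ.suc m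
  step = ℕ-solve-∀

fourth : ℕ → ℕ
fourth x = (x ℕ.* x) ℕ.* (x ℕ.* x)

fourth≡□*□ : ∀ x → + fourth x ≡ □ x * □ x
fourth≡□*□ x = ℤ.pos-* (x ℕ.* x) (x ℕ.* x)

squaredDifference : ℕ → ℕ → ℤ
squaredDifference x y = (+ x - + y) * (+ x - + y)

squaredDifference-sym : ∀ x y → squaredDifference x y ≡ squaredDifference y x
squaredDifference-sym x y = lemma (+ x) (+ y)
  where
  lemma : ∀ a b → (a - b) * (a - b) ≡ (b - a) * (b - a)
  lemma = solve-∀

-- The comparison concerns the natural numbers i and j, not residues, so the signs of the factors
-- record the relative order of a, b, ā and b̄.
orientedDifference : ℕ → ℕ → ℤ
orientedDifference i j = if ⌊ i ℕ.<? j ⌋ then □ j - □ i else □ i - □ j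

orientedDifference-< : ∀ {i j} → i ℕ.< j → orientedDifference i j ≡ □ j - □ i
orientedDifference-< {i} {j} i<j = if-yes (i ℕ.<? j) i<j

orientedDifference-> : ∀ {i j} → j ℕ.< i → orientedDifference i j ≡ □ i - □ j
orientedDifference-> {i} {j} j<i = if-no (i ℕ.<? j) (ℕ.<⇒≯ j<i)

orientedDifference-sym : ∀ i j → orientedDifference i j ≡ orientedDifference j i
orientedDifference-sym i j with ℕ.<-cmp i j
... | tri< i<j _ _  = trans (orientedDifference-< i<j) (sym (orientedDifference-> i<j))
... | tri≈ _ refl _ = refl
... | tri> _ _ j<i  = trans (orientedDifference-> j<i) (sym (orientedDifference-< j<i))

-- The involution on the half system and its orbit representatives.

module Pairing (p n : ℕ) .{{_ : NonZero p}} (p-prime : Prime p) (p≡1+4n : p ≡ ℕ.suc (4 ℕ.* n))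
               (g : ℕ) (g-primitive : IsPrimitiveRoot p g) where

  open Congruence p
  open HalfSystem p n p-prime p≡1+4n
  open Powers g g-primitive

  □-bar : ∀ a → □ (bar p a) ≋ - □ a
  □-bar a = begin
    □ (bar p a)     ≈⟨ □-tilde (t ℕ.* a) ⟩
    □ (t ℕ.* a)     ≡⟨ cong (λ x → + x) (regroup t a) ⟩
    + (t ℕ.* t ℕ.* (a ℕ.* a))  ≡⟨ ℤ.pos-* (t ℕ.* t) (a ℕ.* a) ⟩
    □ t * □ a       ≈⟨ *-cong □t≋-1 ≋-refl ⟩
    -1ℤ * □ a       ≡⟨ ℤ.-1*i≡-i (□ a) ⟩
    - □ a           ∎
    where
    open ≋-Reasoning
    regroup : ∀ t a → (t ℕ.* a) ℕ.* (t ℕ.* a) ≡ t ℕ.* t ℕ.* (a ℕ.* a)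
    regroup = ℕ-solve-∀

  -≋0 : ∀ {a} → - a ≋ 0ℤ → a ≋ 0ℤ
  -≋0 {a} -a≋0 = ≋-trans (≋-reflexive (sym (ℤ.neg-involutive a))) (neg-cong -a≋0)

  bar-InHalf : ∀ {a} → InHalf a → InHalf (bar p a)
  bar-InHalf {a} a∈H = tilde-InHalf (t ℕ.* a) λ ta≋0 → InHalf⇒□≢0 a∈H
    (-≋0 (≋-trans (≋-sym (□-bar a)) (≋-trans (□-tilde (t ℕ.* a))
      (≋-trans (≋-reflexive (□≡* (t ℕ.* a))) (*-cong ta≋0 ta≋0)))))

  □-bar-bar : ∀ a → □ (bar p (bar p a)) ≋ □ a
  □-bar-bar a = ≋-trans (□-bar (bar p a))
    (≋-trans (neg-cong (□-bar a)) (≋-reflexive (ℤ.neg-involutive (□ a))))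

  bar-involutive : ∀ {a} → InHalf a → bar p (bar p a) ≡ a
  bar-involutive {a} a∈H = □-injective (bar-InHalf (bar-InHalf a∈H)) a∈H (□-bar-bar a)

  bar-fixed-point-free : ∀ {a} → InHalf a → bar p a ≢ a
  bar-fixed-point-free {a} a∈H ā≡a = [ 2≢0 , InHalf⇒□≢0 a∈H ]′ (*≋0 p-prime (+ 2) (begin
    + 2 * □ a                ≡⟨ double (□ a) ⟩
    □ a - (- □ a)            ≡⟨ cong (λ x → □ x - (- □ a)) ā≡a ⟨
    □ (bar p a) - (- □ a)    ≈⟨ a≋b⇒a-b≋0 (□-bar a) ⟩
    0ℤ                       ∎))
    where
    open ≋-Reasoning
    double : ∀ x → + 2 * x ≡ x - (- x)
    double = solve-∀

  V : List ℕ
  V = Vlist p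

  record InV (x : ℕ) : Set where
    constructor _,_
    field
      inHalf : InHalf x
      below  : x ℕ.< bar p x

  open InV

  ∈⇒InV : ∀ {x} → x ∈ V → InV x
  ∈⇒InV x∈V with x∈range , x<x̄ ← ∈-filter⁻ (λ x → x ℕ.<? bar p x) {xs = range 1 (half p)} x∈V = ∈⇒InHalf x∈range , x<x̄

  InV⇒∈ : ∀ {x} → InV x → x ∈ V
  InV⇒∈ (x∈H , x<x̄) = ∈-filter⁺ (λ x → x ℕ.<? bar p x) (InHalf⇒∈ x∈H) x<x̄

  V-increasing : AllPairs ℕ._<_ V
  V-increasing = AllPairs.filter⁺ (λ x → x ℕ.<? bar p x) (range-increasing (half p))

  ∈V-or-bar∈V : ∀ {x} → InHalf x → InV x ⊎ InV (bar p x)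
  ∈V-or-bar∈V {x} x∈H with ℕ.<-cmp x (bar p x)
  ... | tri< x<x̄ _ _ = inj₁ (x∈H , x<x̄)
  ... | tri≈ _ x≡x̄ _ = contradiction (sym x≡x̄) (bar-fixed-point-free x∈H)
  ... | tri> _ _ x̄<x = inj₂ (bar-InHalf x∈H , subst (bar p x ℕ.<_) (sym (bar-involutive x∈H)) x̄<x)

  -- If a = b̄ then ā = b, so a < ā and b < b̄ contradict each other.
  V∩bar[V]≡∅ : ∀ {a b} → InV a → InV b → a ≢ bar p b
  V∩bar[V]≡∅ {a} {b} a∈V b∈V refl =
    ℕ.<-asym (below b∈V) (subst (bar p b ℕ.<_) (bar-involutive (inHalf b∈V)) (below a∈V))

  bar-injective : ∀ {a b} → InHalf a → InHalf b → bar p a ≡ bar p b → a ≡ b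
  bar-injective a∈H b∈H ā≡b̄ = trans (sym (bar-involutive a∈H)) (trans (cong (bar p) ā≡b̄) (bar-involutive b∈H))

  V++bar[V]↭half : V ++ map (bar p) V ↭ range 1 (half p)
  V++bar[V]↭half = unique-↭
    (++⁺ (AllPairs-∈-map (λ _ _ → ℕ.<⇒≢) V-increasing)
      (AllPairs.map⁺ (AllPairs-∈-map
        (λ a∈V b∈V a<b ā≡b̄ → ℕ.<⇒≢ a<b (bar-injective (inHalf (∈⇒InV a∈V)) (inHalf (∈⇒InV b∈V)) ā≡b̄))
        V-increasing))
      disjoint)
    (range-unique (half p)) ⊆-half half-⊆
    where
    disjoint : ∀ {z} → ¬ (z ∈ V × z ∈ map (bar p) V)
    disjoint (z∈V , z∈V̄) with b , b∈V , refl ← ∈-map⁻ (bar p) z∈V̄ =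
      V∩bar[V]≡∅ (∈⇒InV z∈V) (∈⇒InV b∈V) refl
    ⊆-half : ∀ {z} → z ∈ V ++ map (bar p) V → z ∈ range 1 (half p)
    ⊆-half z∈ with ∈-++⁻ V z∈
    ... | inj₁ z∈V = InHalf⇒∈ (inHalf (∈⇒InV z∈V))
    ... | inj₂ z∈V̄ with b , b∈V , refl ← ∈-map⁻ (bar p) z∈V̄ = InHalf⇒∈ (bar-InHalf (inHalf (∈⇒InV b∈V)))
    half-⊆ : ∀ {z} → z ∈ range 1 (half p) → z ∈ V ++ map (bar p) V
    half-⊆ {z} z∈ with z∈H ← ∈⇒InHalf z∈ with ∈V-or-bar∈V z∈H
    ... | inj₁ z∈V = ∈-++⁺ˡ (InV⇒∈ z∈V)
    ... | inj₂ z̄∈V = ∈-++⁺ʳ V (subst (_∈ map (bar p) V) (bar-involutive z∈H) (∈-map⁺ (bar p) (InV⇒∈ z̄∈V)))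

  □-injective-V : ∀ {a b} → InV a → InV b → a ≢ b → ¬ □ a ≋ □ b
  □-injective-V a∈V b∈V a≢b □a≋□b = a≢b (□-injective (inHalf a∈V) (inHalf b∈V) □a≋□b)

  □-V-≢- : ∀ {a b} → InV a → InV b → ¬ □ a ≋ - □ b
  □-V-≢- {a} {b} a∈V b∈V □a≋-□b = V∩bar[V]≡∅ a∈V b∈V
    (□-injective (inHalf a∈V) (bar-InHalf (inHalf b∈V)) (≋-trans □a≋-□b (≋-sym (□-bar b))))

  fourth-□ : ∀ {x y} → □ x ≋ □ y → + fourth x ≋ + fourth y
  fourth-□ {x} {y} □x≋□y = ≋-trans (≋-reflexive (fourth≡□*□ x))
    (≋-trans (*-cong □x≋□y □x≋□y) (≋-reflexive (sym (fourth≡□*□ y))))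

  fourth-bar : ∀ x → + fourth (bar p x) ≋ + fourth x
  fourth-bar x = begin
    + fourth (bar p x)           ≡⟨ fourth≡□*□ (bar p x) ⟩
    □ (bar p x) * □ (bar p x)    ≈⟨ *-cong (□-bar x) (□-bar x) ⟩
    (- □ x) * (- □ x)            ≡⟨ neg*neg (□ x) ⟩
    □ x * □ x                    ≡⟨ fourth≡□*□ x ⟨
    + fourth x                   ∎
    where open ≋-Reasoning

  -- Fourth powers of V against powers of g⁴.

  G : ℕ → ℕ
  G r = g ℕ.^ (4 ℕ.* r)

  G≡γ^ : ∀ r → + G r ≡ γ ^ (4 ℕ.* r)
  G≡γ^ r = pos-^ g (4 ℕ.* r)

  fourth≋G : ∀ x k → + x ≋ γ ^ k → + fourth x ≋ + G k
  fourth≋G x k x≋γ^k = begin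
    + fourth x                                  ≡⟨ fourth≡□*□ x ⟩
    □ x * □ x                                   ≡⟨ cong (λ z → z * z) (□≡* x) ⟩
    + x * + x * (+ x * + x)                     ≈⟨ *-cong (*-cong x≋γ^k x≋γ^k) (*-cong x≋γ^k x≋γ^k) ⟩
    γ ^ k * γ ^ k * (γ ^ k * γ ^ k)             ≡⟨ regroup (γ ^ k) ⟩
    (γ ^ k) ^ 4                                 ≡⟨ ℤ.^-*-assoc γ k 4 ⟩
    γ ^ (k ℕ.* 4)                               ≡⟨ cong (γ ^_) (ℕ.*-comm k 4) ⟩
    γ ^ (4 ℕ.* k)                               ≡⟨ G≡γ^ k ⟨
    + G k                                       ∎
    where
    open ≋-Reasoning
    regroup : ∀ a → a * a * (a * a) ≡ a * (a * (a * (a * 1ℤ)))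
    regroup = solve-∀

  G-periodic : ∀ k → ∃ λ r → 0 ℕ.< r × r ℕ.≤ n × + G k ≋ + G r
  G-periodic k = representative (k % n) (m%n<n k n) G[k]≋G[k%n]
    where
    instance
      n≢0 : NonZero n
      n≢0 = ℕ.>-nonZero 0<n
    open ≋-Reasoning
    expand : ∀ q r n → 4 ℕ.* (r + q ℕ.* n) ≡ 4 ℕ.* r + 4 ℕ.* n ℕ.* q
    expand = ℕ-solve-∀
    G[k]≋G[k%n] : + G k ≋ + G (k % n)
    G[k]≋G[k%n] = begin
      + G k                                              ≡⟨ G≡γ^ k ⟩
      γ ^ (4 ℕ.* k)                                      ≡⟨ cong (λ m → γ ^ (4 ℕ.* m)) (m≡m%n+[m/n]*n k n) ⟩
      γ ^ (4 ℕ.* (k % n + k / n ℕ.* n))                  ≡⟨ cong (γ ^_) (expand (k / n) (k % n) n) ⟩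
      γ ^ (4 ℕ.* (k % n) + 4 ℕ.* n ℕ.* (k / n))          ≡⟨ ℤ.^-distribˡ-+-* γ (4 ℕ.* (k % n)) _ ⟩
      γ ^ (4 ℕ.* (k % n)) * γ ^ (4 ℕ.* n ℕ.* (k / n))    ≡⟨ cong (γ ^ (4 ℕ.* (k % n)) *_) (ℤ.^-*-assoc γ (4 ℕ.* n) (k / n)) ⟨
      γ ^ (4 ℕ.* (k % n)) * (γ ^ (4 ℕ.* n)) ^ (k / n)    ≈⟨ *-cong (≋-refl {γ ^ (4 ℕ.* (k % n))}) (^-cong (k / n) γ^[4n]≋1) ⟩
      γ ^ (4 ℕ.* (k % n)) * 1ℤ ^ (k / n)                 ≡⟨ cong (γ ^ (4 ℕ.* (k % n)) *_) (ℤ.^-zeroˡ (k / n)) ⟩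
      γ ^ (4 ℕ.* (k % n)) * 1ℤ                           ≡⟨ ℤ.*-identityʳ _ ⟩
      γ ^ (4 ℕ.* (k % n))                                ≡⟨ G≡γ^ (k % n) ⟨
      + G (k % n)                                        ∎
    representative : ∀ r → r ℕ.< n → + G k ≋ + G r → ∃ λ r → 0 ℕ.< r × r ℕ.≤ n × + G k ≋ + G r
    -- The product on the right is indexed by 1, ..., n, so the residue class 0 is represented by n.
    representative ℕ.zero    _   G[k]≋1 = n , 0<n , ℕ.≤-refl ,
      ≋-trans G[k]≋1 (≋-trans (≋-sym γ^[4n]≋1) (≋-reflexive (sym (G≡γ^ n))))
    representative (ℕ.suc r) r<n eq     = ℕ.suc r , ℕ.z<s , ℕ.<⇒≤ r<n , eq

  -- Entries are reduced modulo p so that congruent ones become equal. On V, a⁴ ≡ b⁴ gives a² ≡ ±b²;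
  -- the plus sign forces a = b and the minus sign a = b̄, which V excludes. Every g⁴ʳ is reached
  -- because the absolute residue of gʳ and its partner have the same fourth power, and one of the
  -- two lies in V.
  fourth-powers-↭ : map (λ a → fourth a % p) V ↭ map (λ r → G r % p) (range 1 (quarter p))
  fourth-powers-↭ = unique-↭
    (AllPairs.map⁺ (AllPairs-∈-map (λ a∈V b∈V a<b eq → fourth-distinct (∈⇒InV a∈V) (∈⇒InV b∈V) a<b (%≡%⇒≋ eq)) V-increasing))
    (AllPairs.map⁺ (AllPairs-∈-map G-distinct (range-increasing (quarter p))))
    V-⊆ ⊆-V
    where
    fourth-distinct : ∀ {a b} → InV a → InV b → a ℕ.< b → ¬ + fourth a ≋ + fourth b
    fourth-distinct {a} {b} a∈V b∈V a<b eq =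
      [ □-injective-V a∈V b∈V (ℕ.<⇒≢ a<b) , □-V-≢- a∈V b∈V ]′
        (squares≋ p-prime (□ a) (□ b)
          (≋-trans (≋-reflexive (sym (fourth≡□*□ a))) (≋-trans eq (≋-reflexive (fourth≡□*□ b)))))
    G-distinct : ∀ {r s} → r ∈ range 1 (quarter p) → s ∈ range 1 (quarter p) → r ℕ.< s → G r % p ≢ G s % p
    -- Since r ≥ 1, the exponents satisfy 4r < 4s ≤ 4n < 4r + 4n.
    G-distinct {r} {s} r∈ s∈ r<s eq = γ^-injective (ℕ.*-monoʳ-< 4 r<s)
      (ℕ.≤-<-trans (ℕ.*-monoʳ-≤ 4 (subst (s ℕ.≤_) quarter≡n (proj₂ (∈-range⁻ s∈))))
        (ℕ.m<n+m (4 ℕ.* n) (ℕ.≤-trans ℕ.z<s (ℕ.*-monoʳ-≤ 4 (proj₁ (∈-range⁻ r∈))))))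
      (≋-trans (≋-reflexive (sym (G≡γ^ r))) (≋-trans (%≡%⇒≋ eq) (≋-reflexive (G≡γ^ s))))
    V-⊆ : ∀ {z} → z ∈ map (λ a → fourth a % p) V → z ∈ map (λ r → G r % p) (range 1 (quarter p))
    V-⊆ z∈ with a , a∈V , refl ← ∈-map⁻ (λ a → fourth a % p) z∈
      with k , _ , a≋γ^k ← discrete-log a (InHalf⇒≢0 (inHalf (∈⇒InV a∈V)))
      with r , 0<r , r≤n , G[k]≋G[r] ← G-periodic k =
      subst (_∈ map (λ r → G r % p) (range 1 (quarter p)))
        (sym (≋⇒%≡% {x = fourth a} {y = G r} (≋-trans (fourth≋G a k a≋γ^k) G[k]≋G[r])))
        (∈-map⁺ (λ r → G r % p) (∈-range⁺ 0<r (subst (r ℕ.≤_) (sym quarter≡n) r≤n)))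
    ⊆-V : ∀ {z} → z ∈ map (λ r → G r % p) (range 1 (quarter p)) → z ∈ map (λ a → fourth a % p) V
    ⊆-V z∈ with r , _ , refl ← ∈-map⁻ (λ r → G r % p) z∈ =
      [ (λ h∈V → hit h∈V fourth[h]≋G[r])
      , (λ h̄∈V → hit h̄∈V (≋-trans (fourth-bar h) fourth[h]≋G[r]))
      ]′ (∈V-or-bar∈V (tilde-InHalf (g ℕ.^ r) (g^≢0 r)))
      where
      h : ℕ
      h = tilde p (g ℕ.^ r)
      fourth[h]≋G[r] : + fourth h ≋ + G r
      fourth[h]≋G[r] = ≋-trans (fourth-□ {h} {g ℕ.^ r} (□-tilde (g ℕ.^ r)))
        (fourth≋G (g ℕ.^ r) r (≋-reflexive (pos-^ g r)))
      hit : ∀ {a} → InV a → + fourth a ≋ + G r → G r % p ∈ map (λ a → fourth a % p) V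
      hit {a} a∈V eq = subst (_∈ map (λ a → fourth a % p) V) (≋⇒%≡% {x = fourth a} {y = G r} eq)
        (∈-map⁺ (λ a → fourth a % p) (InV⇒∈ a∈V))

  -- The left-hand side as a product of signed blocks.

  sumsToZero : ℕ → ℕ → Bool
  sumsToZero i j = ⌊ (i ℕ.* i + j ℕ.* j) % p ℕ.≟ 0 ⌋

  -- Excluded pairs carry the neutral factor 1 instead of being dropped; `F` is then a symmetric
  -- function on all pairs, as `pairs-↭` requires.
  F : ℕ → ℕ → ℤ
  F i j = if sumsToZero i j then 1ℤ else orientedDifference i j

  F-sym : ∀ i j → F i j ≡ F j i
  F-sym i j = cong₂ (λ s d → if ⌊ s % p ℕ.≟ 0 ⌋ then 1ℤ else d)
    (ℕ.+-comm (i ℕ.* i) (j ℕ.* j)) (orientedDifference-sym i j)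

  F-zero : ∀ {i j} → □ i ≋ - □ j → F i j ≡ 1ℤ
  F-zero {i} {j} □i≋-□j = if-yes ((i ℕ.* i + j ℕ.* j) % p ℕ.≟ 0)
    (≋⇒≡ (m%n<n _ p) (ℕ.<-trans ℕ.z<s 1<p) (begin
      + ((i ℕ.* i + j ℕ.* j) % p)   ≈⟨ %-≋ (i ℕ.* i + j ℕ.* j) ⟩
      + (i ℕ.* i + j ℕ.* j)         ≡⟨ ℤ.pos-+ (i ℕ.* i) (j ℕ.* j) ⟩
      □ i ℤ.+ □ j                   ≈⟨ +-cong □i≋-□j (≋-refl {□ j}) ⟩
      - □ j ℤ.+ □ j                 ≡⟨ ℤ.+-inverseˡ (□ j) ⟩
      0ℤ                            ∎))
    where open ≋-Reasoning

  F-nonzero : ∀ {i j} → ¬ □ i ≋ - □ j → F i j ≡ orientedDifference i j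
  F-nonzero {i} {j} □i≢-□j = if-no ((i ℕ.* i + j ℕ.* j) % p ℕ.≟ 0) λ ≡0 → □i≢-□j (a-b≋0⇒a≋b (begin
    □ i - (- □ j)                 ≡⟨ cong (λ z → □ i ℤ.+ z) (ℤ.neg-involutive (□ j)) ⟩
    □ i ℤ.+ □ j                   ≡⟨ ℤ.pos-+ (i ℕ.* i) (j ℕ.* j) ⟨
    + (i ℕ.* i + j ℕ.* j)         ≈⟨ %-≋ (i ℕ.* i + j ℕ.* j) ⟨
    + ((i ℕ.* i + j ℕ.* j) % p)   ≡⟨ cong (λ x → + x) ≡0 ⟩
    0ℤ                            ∎))
    where open ≋-Reasoning

  lhs≋pairs : lhs p ≋ pairs F (range 1 (half p))
  lhs≋pairs = begin
    lhs p
      ≡⟨ prodℤ-concatMap (λ j → concatMap (factor j) (range 1 (j ℕ.∸ 1))) (range 1 (half p)) ⟩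
    ∏ (range 1 (half p)) (λ j → prodℤ (concatMap (factor j) (range 1 (j ℕ.∸ 1))))
      ≡⟨ ∏-cong (λ j → prodℤ-concatMap (factor j) (range 1 (j ℕ.∸ 1))) (range 1 (half p)) ⟩
    ∏ (range 1 (half p)) (λ j → ∏ (range 1 (j ℕ.∸ 1)) (λ i → prodℤ (factor j i)))
      ≈⟨ ∏-≋ (range 1 (half p)) (λ {j} j∈ → ∏-≋ (range 1 (j ℕ.∸ 1)) λ i∈ → ≋-reflexive (factor≡F (i<j j∈ i∈))) ⟩
    ∏ (range 1 (half p)) (λ j → ∏ (range 1 (j ℕ.∸ 1)) (λ i → F i j))
      ≡⟨ ∏∏range≡pairs F F-sym (half p) ⟩
    pairs F (range 1 (half p)) ∎
    where
    open ≋-Reasoning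
    factor : ℕ → ℕ → List ℤ
    factor j i = if sumsToZero i j then [] else (□ j - □ i) ∷ []
    i<j : ∀ {i j m} → j ∈ range 1 m → i ∈ range 1 (j ℕ.∸ 1) → i ℕ.< j
    i<j {j = ℕ.zero}  j∈ _  = contradiction (proj₁ (∈-range⁻ j∈)) λ ()
    i<j {j = ℕ.suc j} _  i∈ = ℕ.s≤s (proj₂ (∈-range⁻ i∈))
    factor≡F : ∀ {i j} → i ℕ.< j → prodℤ (factor j i) ≡ F i j
    factor≡F {i} {j} i<j = trans (prodℤ-if (sumsToZero i j) _)
      (cong (λ d → if sumsToZero i j then 1ℤ else d) (sym (orientedDifference-< i<j)))

  quadruple : ℕ → ℕ → ℤ
  quadruple a b = F a b * ((F a (bar p b) * F b (bar p a)) * F (bar p a) (bar p b))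

  pairs-half≡pairs-V : pairs F (range 1 (half p)) ≡ pairs quadruple V
  pairs-half≡pairs-V = begin
    pairs F (range 1 (half p))
      ≡⟨ pairs-↭ F F-sym V++bar[V]↭half ⟨
    pairs F (V ++ map (bar p) V)
      ≡⟨ pairs-doubling F (bar p) V ⟩
    ∏ V (λ a → F a (bar p a)) * pairs quadruple V
      ≡⟨ cong (_* pairs quadruple V) (trans (∏-cong (λ a → F-zero {a} {bar p a} (□a≋-□ā a)) V) (∏-1 V)) ⟩
    1ℤ * pairs quadruple V
      ≡⟨ ℤ.*-identityˡ (pairs quadruple V) ⟩
    pairs quadruple V ∎
    where
    open ≡-Reasoning
    □a≋-□ā : ∀ a → □ a ≋ - □ (bar p a)
    □a≋-□ā a = ≋-trans (≋-reflexive (sym (ℤ.neg-involutive (□ a)))) (neg-cong (≋-sym (□-bar a)))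

  -- -1 if (a , b) ∈ X and 1 otherwise; the tests are nested in the order in which Xlist filters.
  σ : ℕ → ℕ → ℤ
  σ a b = if does (bar p a ℕ.<? bar p b)
          then (if does (b ℕ.<? bar p a) then (if does (a ℕ.<? b) then -1ℤ else 1ℤ) else 1ℤ)
          else 1ℤ

  σ-X : ∀ {a b} → a ℕ.< b → b ℕ.< bar p a → bar p a ℕ.< bar p b → σ a b ≡ -1ℤ
  σ-X {a} {b} a<b b<ā ā<b̄
    rewrite dec-true (bar p a ℕ.<? bar p b) ā<b̄ | dec-true (b ℕ.<? bar p a) b<ā | dec-true (a ℕ.<? b) a<b = refl

  σ-disordered : ∀ {a b} → ¬ a ℕ.< b → σ a b ≡ 1ℤ
  σ-disordered {a} {b} a≮b rewrite dec-false (a ℕ.<? b) a≮b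
    with does (bar p a ℕ.<? bar p b) | does (b ℕ.<? bar p a)
  ... | true  | true  = refl
  ... | true  | false = refl
  ... | false | _     = refl

  σ-separated : ∀ {a b} → ¬ b ℕ.< bar p a → σ a b ≡ 1ℤ
  σ-separated {a} {b} b≮ā rewrite dec-false (b ℕ.<? bar p a) b≮ā with does (bar p a ℕ.<? bar p b)
  ... | true  = refl
  ... | false = refl

  σ-nested : ∀ {a b} → ¬ bar p a ℕ.< bar p b → σ a b ≡ 1ℤ
  σ-nested {a} {b} ā≮b̄ rewrite dec-false (bar p a ℕ.<? bar p b) ā≮b̄ = refl

  -- `Xlist` scans all ordered pairs from V, so each unordered pair collects both orders; the test a
  -- < b lets at most one of them contribute -1, and none on the diagonal.
  [-1]^cardX≡pairs-σ : -1ℤ ^ cardX p ≡ pairs (λ a b → σ a b * σ b a) V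
  [-1]^cardX≡pairs-σ = begin
    -1ℤ ^ cardX p
      ≡⟨ ∏-const -1ℤ (Xlist p) ⟨
    ∏ (Xlist p) (λ _ → -1ℤ)
      ≡⟨ ∏-concatMap (λ _ → -1ℤ) (λ a → map (λ b → a , b) (partners a)) V ⟩
    ∏ V (λ a → ∏ (map (λ b → a , b) (partners a)) (λ _ → -1ℤ))
      ≡⟨ ∏-cong (λ a → trans (∏-map (λ _ → -1ℤ) (λ b → a , b) (partners a)) (∏-partners a)) V ⟩
    ∏ V (λ a → ∏ V (σ a))
      ≡⟨ ∏∏≡diagonal*pairs σ V ⟩
    ∏ V (λ a → σ a a) * pairs (λ a b → σ a b * σ b a) V
      ≡⟨ cong (_* pairs (λ a b → σ a b * σ b a) V)
           (trans (∏-cong (λ a → σ-disordered (ℕ.<-irrefl {a} refl)) V) (∏-1 V)) ⟩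
    1ℤ * pairs (λ a b → σ a b * σ b a) V
      ≡⟨ ℤ.*-identityˡ _ ⟩
    pairs (λ a b → σ a b * σ b a) V ∎
    where
    open ≡-Reasoning
    partners : ℕ → List ℕ
    partners a = filter (λ b → a ℕ.<? b) (filter (λ b → b ℕ.<? bar p a) (filter (λ b → bar p a ℕ.<? bar p b) V))
    ∏-partners : ∀ a → ∏ (partners a) (λ _ → -1ℤ) ≡ ∏ V (σ a)
    ∏-partners a =
      trans (∏-filter (λ b → a ℕ.<? b) (λ _ → -1ℤ) (filter (λ b → b ℕ.<? bar p a) (filter (λ b → bar p a ℕ.<? bar p b) V)))
      (trans (∏-filter (λ b → b ℕ.<? bar p a) _ (filter (λ b → bar p a ℕ.<? bar p b) V))
        (∏-filter (λ b → bar p a ℕ.<? bar p b) _ V))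

  -- Put A = a² and B = b²; the partners have squares -A and -B. Each of A - B and A + B then occurs
  -- twice up to sign, which gives ±(A² - B²)². The order fixes the signs of `F a b` and
  -- `F a (bar p b)`, and three cases remain: a < ā < b < b̄ has sign +, moving b below ā reverses
  -- one factor, and moving b̄ below ā as well reverses a second. Only the crossing order a < b < ā
  -- < b̄ keeps the minus sign.
  quadruple≋ : ∀ {a b} → InV a → InV b → a ℕ.< b →
    quadruple a b ≋ (σ a b * σ b a) * squaredDifference (fourth a) (fourth b)
  quadruple≋ {a} {b} a∈V b∈V a<b = result (ℕ.<-cmp b (bar p a))
    where
    ā b̄ : ℕ
    ā = bar p a
    b̄ = bar p b

    D : ℤ
    D = squaredDifference (fourth a) (fourth b)

    D≡ : D ≡ (□ a * □ a - □ b * □ b) * (□ a * □ a - □ b * □ b)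
    D≡ = cong₂ (λ x y → (x - y) * (x - y)) (fourth≡□*□ a) (fourth≡□*□ b)

    a≢b : a ≢ b
    a≢b = ℕ.<⇒≢ a<b

    neg-swap : ∀ {x y} → - x ≋ - y → x ≋ y
    neg-swap {x} {y} -x≋-y = ≋-trans (≋-reflexive (sym (ℤ.neg-involutive x)))
      (≋-trans (neg-cong -x≋-y) (≋-reflexive (ℤ.neg-involutive y)))

    □≢-□bar : ∀ {c d} → InV c → InV d → c ≢ d → ¬ □ c ≋ - □ (bar p d)
    □≢-□bar {c} {d} c∈V d∈V c≢d eq = □-injective-V c∈V d∈V c≢d
      (≋-trans eq (≋-trans (neg-cong (□-bar d)) (≋-reflexive (ℤ.neg-involutive (□ d)))))

    □ā≢-□b̄ : ¬ □ ā ≋ - □ b̄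
    □ā≢-□b̄ eq = □-V-≢- a∈V b∈V (neg-swap (≋-trans (≋-sym (□-bar a)) (≋-trans eq (neg-cong (□-bar b)))))

    ordered : ∀ {x y} {X Y : ℤ} → ¬ □ x ≋ - □ y → □ x ≋ X → □ y ≋ Y → x ℕ.< y → F x y ≋ Y - X
    ordered {x} {y} nonzero □x≋X □y≋Y x<y =
      ≋-trans (≋-reflexive (trans (F-nonzero {x} {y} nonzero) (orientedDifference-< x<y))) (sub-cong □y≋Y □x≋X)

    reversed : ∀ {x y} {X Y : ℤ} → ¬ □ x ≋ - □ y → □ x ≋ X → □ y ≋ Y → y ℕ.< x → F x y ≋ X - Y
    reversed {x} {y} nonzero □x≋X □y≋Y y<x =
      ≋-trans (≋-reflexive (trans (F-nonzero {x} {y} nonzero) (orientedDifference-> y<x))) (sub-cong □x≋X □y≋Y)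

    F[a,b] : F a b ≋ □ b - □ a
    F[a,b] = ordered (□-V-≢- a∈V b∈V) ≋-refl ≋-refl a<b

    F[a,b̄] : F a b̄ ≋ (- □ b) - □ a
    F[a,b̄] = ordered (□≢-□bar a∈V b∈V a≢b) ≋-refl (□-bar b) (ℕ.<-trans a<b (below b∈V))

    σ[b,a]≡1 : σ b a ≡ 1ℤ
    σ[b,a]≡1 = σ-disordered (ℕ.<⇒≯ a<b)

    conclude : ∀ {s x y} → F b ā ≋ x → F ā b̄ ≋ y → σ a b ≡ s →
      ((□ b - □ a) * ((((- □ b) - □ a) * x) * y) ≡
        (s * 1ℤ) * ((□ a * □ a - □ b * □ b) * (□ a * □ a - □ b * □ b))) →
      quadruple a b ≋ (σ a b * σ b a) * D
    conclude {s} {x} {y} F[b,ā] F[ā,b̄] σ≡s identity = begin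
      quadruple a b                                          ≈⟨ *-cong F[a,b] (*-cong (*-cong F[a,b̄] F[b,ā]) F[ā,b̄]) ⟩
      (□ b - □ a) * ((((- □ b) - □ a) * x) * y)              ≡⟨ identity ⟩
      (s * 1ℤ) * ((□ a * □ a - □ b * □ b) * (□ a * □ a - □ b * □ b))  ≡⟨ cong ((s * 1ℤ) *_) D≡ ⟨
      (s * 1ℤ) * D                                           ≡⟨ cong₂ (λ u v → (u * v) * D) σ≡s σ[b,a]≡1 ⟨
      (σ a b * σ b a) * D                                    ∎
      where open ≋-Reasoning

    separated : ∀ A B → (B - A) * ((((- B) - A) * (B - (- A))) * ((- B) - (- A))) ≡
      (1ℤ * 1ℤ) * ((A * A - B * B) * (A * A - B * B))
    separated = solve-∀

    crossing : ∀ A B → (B - A) * ((((- B) - A) * ((- A) - B)) * ((- B) - (- A))) ≡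
      (-1ℤ * 1ℤ) * ((A * A - B * B) * (A * A - B * B))
    crossing = solve-∀

    nested : ∀ A B → (B - A) * ((((- B) - A) * ((- A) - B)) * ((- A) - (- B))) ≡
      (1ℤ * 1ℤ) * ((A * A - B * B) * (A * A - B * B))
    nested = solve-∀

    □b≢-□ā : ¬ □ b ≋ - □ ā
    □b≢-□ā = □≢-□bar b∈V a∈V (λ b≡a → a≢b (sym b≡a))

    overlapping : b ℕ.< ā → Tri (ā ℕ.< b̄) (ā ≡ b̄) (b̄ ℕ.< ā) → quadruple a b ≋ (σ a b * σ b a) * D
    overlapping b<ā (tri≈ _ ā≡b̄ _) = contradiction (bar-injective (inHalf a∈V) (inHalf b∈V) ā≡b̄) a≢b
    overlapping b<ā (tri< ā<b̄ _ _) = conclude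
      (ordered □b≢-□ā ≋-refl (□-bar a) b<ā)
      (ordered □ā≢-□b̄ (□-bar a) (□-bar b) ā<b̄)
      (σ-X a<b b<ā ā<b̄) (crossing (□ a) (□ b))
    overlapping b<ā (tri> ā≮b̄ _ b̄<ā) = conclude
      (ordered □b≢-□ā ≋-refl (□-bar a) b<ā)
      (reversed □ā≢-□b̄ (□-bar a) (□-bar b) b̄<ā)
      (σ-nested ā≮b̄) (nested (□ a) (□ b))

    result : Tri (b ℕ.< ā) (b ≡ ā) (ā ℕ.< b) → quadruple a b ≋ (σ a b * σ b a) * D
    result (tri< b<ā _ _)   = overlapping b<ā (ℕ.<-cmp ā b̄)
    result (tri≈ _ b≡ā _)   = contradiction b≡ā (V∩bar[V]≡∅ b∈V a∈V)
    result (tri> b≮ā _ ā<b) = conclude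
      (reversed □b≢-□ā ≋-refl (□-bar a) ā<b)
      (ordered □ā≢-□b̄ (□-bar a) (□-bar b) (ℕ.<-trans ā<b (below b∈V)))
      (σ-separated b≮ā) (separated (□ a) (□ b))

  -- Both sides reduced to a common discriminant.

  squaredDifference-cong : ∀ {w x y z} → + w ≋ + x → + y ≋ + z → squaredDifference w y ≋ squaredDifference x z
  squaredDifference-cong w≋x y≋z = *-cong (sub-cong w≋x y≋z) (sub-cong w≋x y≋z)

  -- The discriminant of the numbers g⁴, g⁸, ..., g⁴ⁿ. Modulo p it depends only on their set of
  -- residues.
  Δ : ℤ
  Δ = pairs (squaredDifference on G) (range 1 (quarter p))

  lhs≋Δ : lhs p ≋ -1ℤ ^ cardX p * Δ
  lhs≋Δ = begin
    lhs p                                       ≈⟨ lhs≋pairs ⟩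
    pairs F (range 1 (half p))                  ≡⟨ pairs-half≡pairs-V ⟩
    pairs quadruple V                           ≈⟨ pairs-≋ V-increasing (λ a∈V b∈V → quadruple≋ (∈⇒InV a∈V) (∈⇒InV b∈V)) ⟩
    pairs (λ a b → (σ a b * σ b a) * squaredDifference (fourth a) (fourth b)) V
                                                ≡⟨ pairs-* (λ a b → σ a b * σ b a) (squaredDifference on fourth) V ⟩
    pairs (λ a b → σ a b * σ b a) V * pairs (squaredDifference on fourth) V
                                                ≡⟨ cong (_* pairs (squaredDifference on fourth) V) [-1]^cardX≡pairs-σ ⟨
    -1ℤ ^ cardX p * pairs (squaredDifference on fourth) V
                                                ≈⟨ *-cong (≋-refl { -1ℤ ^ cardX p}) fourth-powers≋Δ ⟩
    -1ℤ ^ cardX p * Δ                           ∎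
    where
    open ≋-Reasoning
    residues : ∀ {xs} → AllPairs ℕ._<_ xs → (h : ℕ → ℕ) →
      pairs (squaredDifference on h) xs ≋ pairs squaredDifference (map (λ x → h x % p) xs)
    residues {xs} increasing h = ≋-trans
      (pairs-≋ increasing (λ {x} {y} _ _ _ → squaredDifference-cong {h x} {h x % p} {h y} {h y % p}
        (≋-sym (%-≋ (h x))) (≋-sym (%-≋ (h y)))))
      (≋-reflexive (sym (pairs-map squaredDifference (λ x → h x % p) xs)))
    fourth-powers≋Δ : pairs (squaredDifference on fourth) V ≋ Δ
    fourth-powers≋Δ = begin
      pairs (squaredDifference on fourth) V                        ≈⟨ residues V-increasing fourth ⟩
      pairs squaredDifference (map (λ a → fourth a % p) V)         ≡⟨ pairs-↭ squaredDifference squaredDifference-sym fourth-powers-↭ ⟩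
      pairs squaredDifference (map (λ r → G r % p) (range 1 (quarter p)))
                                                                   ≈⟨ residues (range-increasing (quarter p)) G ⟨
      Δ                                                            ∎

  rhsProd≋Δ : rhsProd p g ≋ -1ℤ ^ triangle n * Δ
  rhsProd≋Δ = begin
    rhsProd p g
      ≡⟨ prodℤ-concatMap (λ r → concatMap (factor r) R) R ⟩
    ∏ R (λ r → prodℤ (concatMap (factor r) R))
      ≡⟨ ∏-cong (λ r → trans (prodℤ-concatMap (factor r) R) (∏-cong (λ s → prodℤ-if ⌊ r ℕ.≟ s ⌋ (+ G r - + G s)) R)) R ⟩
    ∏ R (λ r → ∏ R (λ s → f r s))
      ≡⟨ ∏∏≡diagonal*pairs f R ⟩
    ∏ R (λ r → f r r) * pairs (λ r s → f r s * f s r) R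
      ≡⟨ cong (_* pairs (λ r s → f r s * f s r) R) (trans (∏-cong f-diagonal R) (∏-1 R)) ⟩
    1ℤ * pairs (λ r s → f r s * f s r) R
      ≡⟨ ℤ.*-identityˡ _ ⟩
    pairs (λ r s → f r s * f s r) R
      ≈⟨ pairs-≋ (range-increasing (quarter p)) (λ _ _ r<s → ≋-reflexive (f*f≡ (ℕ.<⇒≢ r<s))) ⟩
    pairs (λ r s → -1ℤ * squaredDifference (G r) (G s)) R
      ≡⟨ pairs-* (λ _ _ → -1ℤ) (squaredDifference on G) R ⟩
    pairs (λ _ _ → -1ℤ) R * Δ
      ≡⟨ cong (_* Δ) (trans (pairs-const -1ℤ R) (cong (λ m → -1ℤ ^ triangle m) length-R)) ⟩
    -1ℤ ^ triangle n * Δ ∎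
    where
    open ≋-Reasoning
    R : List ℕ
    R = range 1 (quarter p)
    length-R : length R ≡ n
    length-R = trans (length-applyUpTo ℕ.suc (quarter p)) quarter≡n
    factor : ℕ → ℕ → List ℤ
    factor r s = if ⌊ r ℕ.≟ s ⌋ then [] else (+ G r - + G s) ∷ []
    f : ℕ → ℕ → ℤ
    f r s = if ⌊ r ℕ.≟ s ⌋ then 1ℤ else + G r - + G s
    f-diagonal : ∀ r → f r r ≡ 1ℤ
    f-diagonal r = if-yes (r ℕ.≟ r) refl
    f-off-diagonal : ∀ {r s} → r ≢ s → f r s ≡ + G r - + G s
    f-off-diagonal {r} {s} r≢s = if-no (r ℕ.≟ s) r≢s
    swap-sign : ∀ a b → (a - b) * (b - a) ≡ -1ℤ * ((a - b) * (a - b))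
    swap-sign = solve-∀
    f*f≡ : ∀ {r s} → r ≢ s → f r s * f s r ≡ -1ℤ * squaredDifference (G r) (G s)
    f*f≡ {r} {s} r≢s = trans (cong₂ _*_ (f-off-diagonal r≢s) (f-off-diagonal (r≢s ∘ sym)))
      (swap-sign (+ G r) (+ G s))

  -- Exactness of Lp and comparison of the signs.

  -- One of n and n - 1 is divisible by 3 unless n ≡ 2 modulo 3, and in that case 4n + 1 is a
  -- multiple of 3 that is at least 9.
  3∣triangle : 3 ∣ triangle n
  3∣triangle = go n p≡1+4n 0<n
    where
    -- With T the triangular number, 3 divides 2T, hence 4T = 3T + T, hence T.
    3∣product⇒3∣triangle : ∀ m → 3 ∣ ℕ.suc m ℕ.* m → 3 ∣ triangle (ℕ.suc m)
    3∣product⇒3∣triangle m 3∣[1+m]m = ∣m+n∣m⇒∣n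
      (subst (3 ∣_) (trans (cong (2 ℕ.*_) (sym (2*triangle m))) (quadruple≡ (triangle (ℕ.suc m)))) (∣n⇒∣m*n 2 3∣[1+m]m))
      (m∣m*n (triangle (ℕ.suc m)))
      where
      quadruple≡ : ∀ x → 2 ℕ.* (2 ℕ.* x) ≡ 3 ℕ.* x + x
      quadruple≡ = ℕ-solve-∀
    -- Irreducibility leaves 3 = 1 or 3 = p; a cofactor of at least 3 rules out the second.
    3∤p : ∀ q → p ≢ (3 + q) ℕ.* 3
    3∤p q p≡ with prime⇒irreducible p-prime (divides (3 + q) p≡)
    ... | inj₁ ()
    ... | inj₂ 3≡p = 3≢9+3q (trans 3≡p p≡)
      where
      3≢9+3q : 3 ≢ (3 + q) ℕ.* 3
      3≢9+3q ()
    byResidue : ∀ m q r → r ℕ.< 3 → m ≡ r + q ℕ.* 3 → p ≡ ℕ.suc (4 ℕ.* ℕ.suc m) → 3 ∣ ℕ.suc m ℕ.* m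
    byResidue m q 0 _ refl p≡ = ∣n⇒∣m*n (ℕ.suc m) (divides q refl)
    -- Here n = m + 1 = 3q + 2, so p = 12q + 9 = 3(3 + 4q).
    byResidue m q 1 _ refl p≡ = contradiction (trans p≡ (expand q)) (3∤p (4 ℕ.* q))
      where
      expand : ∀ q → ℕ.suc (4 ℕ.* ℕ.suc (1 + q ℕ.* 3)) ≡ (3 + 4 ℕ.* q) ℕ.* 3
      expand = ℕ-solve-∀
    byResidue m q 2 _ refl p≡ = ∣m⇒∣m*n m (divides (ℕ.suc q) refl)
    byResidue m q (ℕ.suc (ℕ.suc (ℕ.suc r))) r<3 _ _ = contradiction r<3 λ { (ℕ.s≤s (ℕ.s≤s (ℕ.s≤s ()))) }
    go : ∀ n → p ≡ ℕ.suc (4 ℕ.* n) → 0 ℕ.< n → 3 ∣ triangle n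
    go (ℕ.suc m) p≡ _ = 3∣product⇒3∣triangle m
      (byResidue m (m / 3) (m % 3) (m%n<n m 3) (m≡m%n+[m/n]*n m 3) p≡)

  -- (p - 1)(p - 5) = 16n(n - 1) = 32 `triangle n` = 96k, so the division by 96 leaves no remainder.
  Lp≡triangle/3 : ∀ k → triangle n ≡ k ℕ.* 3 → Lp p ≡ k
  Lp≡triangle/3 k triangle≡3k = trans (cong (_/ 96) (go n p≡1+4n 0<n triangle≡3k)) (m*n/n≡m k 96)
    where
    16[m+1]m : ∀ m → (4 ℕ.* ℕ.suc m) ℕ.* (4 ℕ.* m) ≡ 16 ℕ.* (ℕ.suc m ℕ.* m)
    16[m+1]m = ℕ-solve-∀
    96k : ∀ k → 16 ℕ.* (2 ℕ.* (k ℕ.* 3)) ≡ k ℕ.* 96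
    96k = ℕ-solve-∀
    expand : ∀ m → ℕ.suc (4 ℕ.* ℕ.suc m) ≡ 5 + 4 ℕ.* m
    expand = ℕ-solve-∀
    -- Positivity of n gives p ≥ 5, so `p ℕ.∸ 5` is a true difference.
    go : ∀ n → p ≡ ℕ.suc (4 ℕ.* n) → 0 ℕ.< n → triangle n ≡ k ℕ.* 3 → (p ℕ.∸ 1) ℕ.* (p ℕ.∸ 5) ≡ k ℕ.* 96
    go (ℕ.suc m) p≡ _ triangle≡ = begin
      (p ℕ.∸ 1) ℕ.* (p ℕ.∸ 5)             ≡⟨ cong₂ ℕ._*_ (cong (ℕ._∸ 1) p≡) (cong (ℕ._∸ 5) (trans p≡ (expand m))) ⟩
      (4 ℕ.* ℕ.suc m) ℕ.* (4 ℕ.* m)       ≡⟨ 16[m+1]m m ⟩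
      16 ℕ.* (ℕ.suc m ℕ.* m)              ≡⟨ cong (16 ℕ.*_) (2*triangle m) ⟨
      16 ℕ.* (2 ℕ.* triangle (ℕ.suc m))   ≡⟨ cong (λ x → 16 ℕ.* (2 ℕ.* x)) triangle≡ ⟩
      16 ℕ.* (2 ℕ.* (k ℕ.* 3))            ≡⟨ 96k k ⟩
      k ℕ.* 96                            ∎
      where open ≡-Reasoning

  -- The exponents are k and 3k, with sum 4k. The form of a product equal to 1 lets both signs be
  -- inserted in front of `Δ`.
  signs-cancel : -1ℤ ^ Lp p * -1ℤ ^ triangle n ≡ 1ℤ
  signs-cancel with divides k triangle≡3k ← 3∣triangle = begin
    -1ℤ ^ Lp p * -1ℤ ^ triangle n     ≡⟨ cong₂ (λ x y → -1ℤ ^ x * -1ℤ ^ y) (Lp≡triangle/3 k triangle≡3k) triangle≡3k ⟩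
    -1ℤ ^ k * -1ℤ ^ (k ℕ.* 3)         ≡⟨ ℤ.^-distribˡ-+-* -1ℤ k (k ℕ.* 3) ⟨
    -1ℤ ^ (k + k ℕ.* 3)               ≡⟨ cong (-1ℤ ^_) (4k k) ⟩
    -1ℤ ^ (4 ℕ.* k)                   ≡⟨ ℤ.^-*-assoc -1ℤ 4 k ⟨
    1ℤ ^ k                            ≡⟨ ℤ.^-zeroˡ k ⟩
    1ℤ                                ∎
    where
    open ≡-Reasoning
    4k : ∀ k → k + k ℕ.* 3 ≡ 4 ℕ.* k
    4k = ℕ-solve-∀

  lhs≋rhs : lhs p ≋ -1ℤ ^ (cardX p + Lp p) * rhsProd p g
  lhs≋rhs = begin
    lhs p                                                        ≈⟨ lhs≋Δ ⟩
    -1ℤ ^ cardX p * Δ                                            ≡⟨ cong (-1ℤ ^ cardX p *_) (ℤ.*-identityˡ Δ) ⟨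
    -1ℤ ^ cardX p * (1ℤ * Δ)                                     ≡⟨ cong (λ s → -1ℤ ^ cardX p * (s * Δ)) signs-cancel ⟨
    -1ℤ ^ cardX p * (-1ℤ ^ Lp p * -1ℤ ^ triangle n * Δ)          ≡⟨ regroup (-1ℤ ^ cardX p) (-1ℤ ^ Lp p) (-1ℤ ^ triangle n) Δ ⟩
    (-1ℤ ^ cardX p * -1ℤ ^ Lp p) * (-1ℤ ^ triangle n * Δ)        ≡⟨ cong (_* (-1ℤ ^ triangle n * Δ)) (ℤ.^-distribˡ-+-* -1ℤ (cardX p) (Lp p)) ⟨
    -1ℤ ^ (cardX p + Lp p) * (-1ℤ ^ triangle n * Δ)              ≈⟨ *-cong (≋-refl { -1ℤ ^ (cardX p + Lp p)}) rhsProd≋Δ ⟨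
    -1ℤ ^ (cardX p + Lp p) * rhsProd p g                         ∎
    where
    open ≋-Reasoning
    regroup : ∀ a b c d → a * (b * c * d) ≡ (a * b) * (c * d)
    regroup = solve-∀

theorem2p2 : (p : ℕ) → .{{_ : NonZero p}} → Prime p → p % 4 ≡ 1 →
    (g : ℕ) → IsPrimitiveRoot p g →
    lhs p ≡ (-1ℤ ^ (cardX p + Lp p)) * rhsProd p g [mod p ]
theorem2p2 p p-prime p%4≡1 g g-primitive = ≋⇒∣ (lhs≋rhs p (p / 4) p-prime p≡1+4n g g-primitive)
  where
  open Congruence p
  open Pairing
  p≡1+4n : p ≡ ℕ.suc (4 ℕ.* (p / 4))
  p≡1+4n = trans (m≡m%n+[m/n]*n p 4) (cong₂ _+_ p%4≡1 (ℕ.*-comm (p / 4) 4))
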